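{- Let $\nu=(\nu_1,\ldots,\nu_\ell)$ be an integer partition. Then the function of partitions $$g_\nu(\lambda):=p_\nu(h_\square^2:\square\in\lambda)=\prod_{i=1}^{\ell}\Bigl(\sum_{\square\in\lambda}h_\square^{2\nu_i}\Bigr)$$ is a $D$-polynomial with degree at most $|\nu|+\ell$; that is, $D^{|\nu|+\ell+1}\bigl(g_\nu(\lambda)/H_\lambda\bigr)=0$ for every partition $\lambda$.
   Context: A partition $\lambda=(\lambda_1\ge\cdots\ge\lambda_\ell>0)$ is identified with its Young diagram; $|\lambda|=\sum\lambda_i$. The hook length $h_\square$ of a box $\square$ is the number of boxes in its arm plus its leg plus one (the box itself). $H_\lambda=\prod_{\square\in\lambda}h_\square$, with $H_\emptyset=1$. $p_\nu=p_{\nu_1}\cdots p_{\nu_\ell}$ is the power sum symmetric function, and $p_\nu(h_\square^2:\square\in\lambda)$ means substituting the $|\lambda|$ values $h_\square^2$ ($\square\in\lambda$) for variables and $0$ for the rest. For a function $g$ on partitions, $Dg(\lambda)=\sum_{\lambda^+}g(\lambda^+)-g(\lambda)$, where $\lambda^+$ ranges over all partitions obtained from $\lambda$ by adding one box; $D^0g=g$, $D^kg=D(D^{k-1}g)$. A function $g$ of partitions is a $D$-polynomial if there is an integer $r$ with $D^{r+1}(g(\lambda)/H_\lambda)=0$ for every partition $\lambda$; the minimal such $r$ is its degree. -}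

module Defs where

open import Data.Nat as ℕ using (ℕ; zero; suc; _∸_; _^_; _<ᵇ_; _<_)
open import Data.Bool using (Bool; true; false; if_then_else_)
open import Data.Maybe using (Maybe; just; nothing)
open import Data.List using (List; []; _∷_; map; length; concat; foldr; upTo; zip)
open import Data.Nat.ListAction using (sum; product)
open import Data.Product using (_×_; _,_; proj₁; proj₂)
open import Data.List.Relation.Unary.All using (All)
open import Data.List.Relation.Unary.Linked using (Linked)
open import Data.Integer using (+_)
open import Data.Rational using (ℚ; 0ℚ; _+_; _-_) renaming (_/_ to _/ℚ_)

IsPartition : List ℕ → Set
IsPartition λ′ = Linked ℕ._≥_ λ′ × All (0 <_) λ′

size : List ℕ → ℕ
size = sum

part : List ℕ → ℕ → ℕ
part []       _       = 0
part (x ∷ _)  zero    = x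
part (_ ∷ xs) (suc i) = part xs i

conjPart : List ℕ → ℕ → ℕ
conjPart []       j = 0
conjPart (x ∷ xs) j = (if j <ᵇ x then 1 else 0) ℕ.+ conjPart xs j

boxes : List ℕ → List (ℕ × ℕ)
boxes λ′ = concat (map (λ p → map (λ j → (p .proj₁ , j)) (upTo (p .proj₂)))
                       (zip (upTo (length λ′)) λ′))

-- hook length of box (i , j): arm + leg + 1 = (λ_i - j - 1) + (λ'_j - i - 1) + 1
hook : List ℕ → ℕ × ℕ → ℕ
hook λ′ (i , j) = ((part λ′ i ∸ j) ℕ.+ (conjPart λ′ j ∸ i)) ∸ 1

Hprod : List ℕ → ℕ
Hprod λ′ = product (map (hook λ′) (boxes λ′))

gν : List ℕ → List ℕ → ℕ
gν ν λ′ = product (map (λ k → sum (map (λ h → h ^ (2 ℕ.* k)) (map (hook λ′) (boxes λ′)))) ν)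

-- a / d as a rational; d = 0 never occurs for d = H_λ of a partition λ
divℚ : ℕ → ℕ → ℚ
divℚ a zero    = 0ℚ
divℚ a (suc d) = (+ a) /ℚ (suc d)

gνOverH : List ℕ → List ℕ → ℚ
gνOverH ν λ′ = divℚ (gν ν λ′) (Hprod λ′)

-- all partitions λ⁺ obtained from λ by adding one box
-- (row i may grow iff i = 0 or λ_{i-1} > λ_i; a new row of length 1 may always be added)
private
  addGo : Maybe ℕ → List ℕ → List (List ℕ)
  addGo prev []       = (1 ∷ []) ∷ []
  addGo prev (x ∷ xs) = grow prev (map (x ∷_) (addGo (just x) xs))
    where
      grow : Maybe ℕ → List (List ℕ) → List (List ℕ)
      grow nothing  r = (suc x ∷ xs) ∷ r
      grow (just p) r = if x <ᵇ p then (suc x ∷ xs) ∷ r else r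

addBox : List ℕ → List (List ℕ)
addBox = addGo nothing

sumℚ : List ℚ → ℚ
sumℚ = foldr _+_ 0ℚ

D : (List ℕ → ℚ) → (List ℕ → ℚ)
D g λ′ = sumℚ (map g (addBox λ′)) - g λ′

Dpow : ℕ → (List ℕ → ℚ) → (List ℕ → ℚ)
Dpow zero    g = g
Dpow (suc k) g = D (Dpow k g)

{-# OPTIONS --safe #-}
-- A box of content c added to λ changes the hook power sums, the power sums over
-- the corners and the moments of c under the transition weights H_λ / H_λ⁺ by
-- polynomials in c whose coefficients are again such functions of λ.  Giving the
-- sum of 2k-th powers of hook lengths weight 2k + 2, and the k-th corner sum and
-- the k-th moment weight k, the change has weight smaller by 2; and averaging c^m
-- over λ⁺ gives the m-th moment.  Hence f ↦ H D(f / H) lowers the weight by 2,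
-- while g_ν has weight 2 (|ν| + ℓ).
module Submission where

open import Defs

-- Everything is defined by recursion on rows, so a box added lower down has to be followed through
-- the factors of all rows above it. The inverse hook product is therefore replaced by `K`, a
-- product over rows of differences divided by factorials. It also makes sense for lists that are
-- not partitions, and it vanishes when a row is made longer than the row above. Hence the sum over
-- λ⁺ may run over all rows without a condition.
--
-- For moments and corner sums the loss of two in weight comes from (1 - c t)² - (1 - (c + 1) t)(1 -
-- (c - 1) t) = t². For hook sums the weight is chosen to fit: the change of a sum of 2k-th powers
-- is a corner sum of (c - s)^(2k), up to a constant.
--
-- Even powers are essential here. The hooks that change are differences of c and corner contents s,
-- with one sign in the row of the new box and the other in the rows above it; only an even function
-- joins the two kinds into one sum over corners.

module Hooks where
  open import Data.Nat using (ℕ; zero; suc; _+_; _∸_; _*_; _≤_; _≥_; _<_; z≤n; s≤s; _<ᵇ_)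
  open import Data.Nat.Properties
  open import Data.Nat.ListAction using (product)
  open import Data.Bool using (true; false)
  open import Data.Bool.Properties using (T-≡)
  open import Data.List using (List; []; _∷_; _++_; map; length; concat; upTo; applyUpTo; zip)
  open import Data.List.Properties using (map-++; map-∘; map-upTo; ++-assoc; ++-identityʳ)
  open import Data.List.Relation.Unary.Linked using (Linked; [-]; _∷_)
  open import Data.List.Relation.Binary.Permutation.Propositional
    using (_↭_; ↭-reflexive; prep; module PermutationReasoning)
  open import Data.List.Relation.Binary.Permutation.Propositional.Properties using (shift; ++-comm; ++⁺ˡ; ++⁺ʳ)
  open import Data.Product using (∃; _×_; _,_; proj₁; proj₂)
  open import Function using (_∘_; id)
  open import Function.Bundles using (module Equivalence)
  open import Relation.Binary.PropositionalEquality

  Linked-skip : ∀ {x y ys} → Linked _≥_ (x ∷ y ∷ ys) → Linked _≥_ (x ∷ ys)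
  Linked-skip (_   ∷ [-])       = [-]
  Linked-skip (x≥y ∷ y≥z ∷ lys) = ≤-trans y≥z x≥y ∷ lys

  Linked-suc : ∀ {x ys} → Linked _≥_ (x ∷ ys) → Linked _≥_ (suc x ∷ ys)
  Linked-suc [-]         = [-]
  Linked-suc (x≥y ∷ lys) = m≤n⇒m≤1+n x≥y ∷ lys

  applyUpTo-cong : ∀ {a} {X : Set a} (f g : ℕ → X) n → (∀ {j} → j < n → f j ≡ g j) → applyUpTo f n ≡ applyUpTo g n
  applyUpTo-cong f g zero    eq = refl
  applyUpTo-cong f g (suc n) eq = cong₂ _∷_ (eq (s≤s z≤n)) (applyUpTo-cong (f ∘ suc) (g ∘ suc) n λ j<n → eq (s≤s j<n))

  applyUpTo-+ : ∀ {a} {X : Set a} (f : ℕ → X) m n → applyUpTo f (m + n) ≡ applyUpTo f m ++ applyUpTo (f ∘ (m +_)) n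
  applyUpTo-+ f zero    n = refl
  applyUpTo-+ f (suc m) n = cong (f 0 ∷_) (applyUpTo-+ (f ∘ suc) m n)

  map-map-upTo : ∀ {a b} {X : Set a} {Y : Set b} (h : X → Y) (e : ℕ → X) n → map h (map e (upTo n)) ≡ applyUpTo (h ∘ e) n
  map-map-upTo h e n = trans (sym (map-∘ (upTo n))) (map-upTo (h ∘ e) n)

  <⇒<ᵇ≡true : ∀ {m n} → m < n → (m <ᵇ n) ≡ true
  <⇒<ᵇ≡true m<n = Equivalence.to T-≡ (<⇒<ᵇ m<n)

  ≥⇒<ᵇ≡false : ∀ {m n} → n ≤ m → (m <ᵇ n) ≡ false
  ≥⇒<ᵇ≡false z≤n       = refl
  ≥⇒<ᵇ≡false (s≤s n≤m) = ≥⇒<ᵇ≡false n≤m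

  -- Hook lengths of one row and their complement.

  downTo : ℕ → ℕ → List ℕ
  downTo s zero    = []
  downTo s (suc d) = (s + suc d) ∷ downTo s d

  downTo-+ : ∀ s m n → downTo s (m + n) ≡ downTo (s + n) m ++ downTo s n
  downTo-+ s zero    n = refl
  downTo-+ s (suc m) n = cong₂ _∷_ (trans (cong (s +_) (+-comm (suc m) n)) (sym (+-assoc s n (suc m)))) (downTo-+ s m n)

  applyUpTo-∸ : ∀ s d → applyUpTo (λ j → s + (d ∸ j)) d ≡ downTo s d
  applyUpTo-∸ s zero    = refl
  applyUpTo-∸ s (suc d) = cong (s + suc d ∷_) (applyUpTo-∸ s d)

  rowHooks : ℕ → List ℕ → List ℕ
  rowHooks x xs = applyUpTo (λ j → (x ∸ j) + conjPart xs j) x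

  -- The numbers between 1 and n + length xs which are not hook lengths of a row
  -- of length n on top of xs.
  nonHooks : ℕ → List ℕ → List ℕ
  nonHooks n []       = []
  nonHooks n (y ∷ ys) = (suc n ∸ y) ∷ nonHooks (suc n) ys

  conjPart≡0 : ∀ {x xs} → Linked _≥_ (x ∷ xs) → ∀ {j} → x ≤ j → conjPart xs j ≡ 0
  conjPart≡0 [-]         x≤j = refl
  conjPart≡0 (x≥y ∷ lys) x≤j rewrite ≥⇒<ᵇ≡false (≤-trans x≥y x≤j) = conjPart≡0 lys (≤-trans x≥y x≤j)

  -- Let `x` be `y + d`. The last `d` columns are empty below and give `s + d, …, s + 1`. The first
  -- `y` columns gain `d` in the arm and one in the leg, so they carry the values for `y` on top of
  -- `ys`, raised by `suc d`. The value `s + suc d` in between is the one left out. The shift `s`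
  -- lets the induction absorb the raise.
  ↭-downTo : ∀ s x xs → Linked _≥_ (x ∷ xs) →
    applyUpTo (λ j → s + ((x ∸ j) + conjPart xs j)) x ++ nonHooks (s + x) xs ↭ downTo s (x + length xs)
  ↭-downTo s x [] l = ↭-reflexive (begin
    applyUpTo (λ j → s + (x ∸ j + 0)) x ++ []  ≡⟨ ++-identityʳ _ ⟩
    applyUpTo (λ j → s + (x ∸ j + 0)) x        ≡⟨ applyUpTo-cong _ _ x (λ _ → cong (s +_) (+-identityʳ _)) ⟩
    applyUpTo (λ j → s + (x ∸ j)) x            ≡⟨ applyUpTo-∸ s x ⟩
    downTo s x                                 ≡⟨ cong (downTo s) (+-identityʳ x) ⟨
    downTo s (x + 0)                           ∎)
    where open ≡-Reasoning
  ↭-downTo s x (y ∷ ys) (x≥y ∷ lys) with m≤n⇒∃[o]m+o≡n x≥y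
  ... | d , refl = begin
    applyUpTo f (y + d) ++ (suc (s + (y + d)) ∸ y) ∷ nonHooks (suc (s + (y + d))) ys
      ≡⟨ cong₂ _++_ (trans (applyUpTo-+ f y d) (cong₂ _++_ left right)) (cong₂ (λ e n → e ∷ nonHooks n ys) missing shifted) ⟩
    (H ++ B) ++ (s + suc d) ∷ C           ↭⟨ shift (s + suc d) (H ++ B) C ⟩
    (s + suc d) ∷ ((H ++ B) ++ C)         ≡⟨ cong (s + suc d ∷_) (++-assoc H B C) ⟩
    (s + suc d) ∷ (H ++ (B ++ C))         ↭⟨ prep (s + suc d) (++⁺ˡ H (++-comm B C)) ⟩
    (s + suc d) ∷ (H ++ (C ++ B))         ≡⟨ cong (s + suc d ∷_) (++-assoc H C B) ⟨
    (s + suc d) ∷ ((H ++ C) ++ B)         ↭⟨ prep (s + suc d) (++⁺ʳ B (↭-downTo (s + suc d) y ys lys)) ⟩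
    (s + suc d) ∷ (downTo (s + suc d) (y + length ys) ++ B) ↭⟨ shift (s + suc d) (downTo (s + suc d) (y + length ys)) B ⟨
    downTo (s + suc d) (y + length ys) ++ (s + suc d) ∷ B   ≡⟨ downTo-+ s (y + length ys) (suc d) ⟨
    downTo s (y + length ys + suc d)      ≡⟨ cong (downTo s) total ⟩
    downTo s (y + d + suc (length ys))    ∎
    where
    open PermutationReasoning
    f : ℕ → ℕ
    f j = s + ((y + d ∸ j) + conjPart (y ∷ ys) j)
    H = applyUpTo (λ j → s + suc d + ((y ∸ j) + conjPart ys j)) y
    B = downTo s d
    C = nonHooks (s + suc d + y) ys
    leftTerm : ∀ {j} → j < y → f j ≡ s + suc d + ((y ∸ j) + conjPart ys j)
    leftTerm {j} j<y rewrite <⇒<ᵇ≡true j<y | +-comm y d | +-∸-assoc d (<⇒≤ j<y)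
      | +-suc (d + (y ∸ j)) (conjPart ys j) | +-assoc d (y ∸ j) (conjPart ys j) = sym (+-assoc s (suc d) _)
    left : applyUpTo f y ≡ H
    left = applyUpTo-cong _ _ y leftTerm
    rightTerm : ∀ i → f (y + i) ≡ s + (d ∸ i)
    rightTerm i rewrite ≥⇒<ᵇ≡false (m≤m+n y i) | conjPart≡0 lys (m≤m+n y i) | [m+n]∸[m+o]≡n∸o y d i = cong (s +_) (+-identityʳ _)
    right : applyUpTo (f ∘ (y +_)) d ≡ B
    right = trans (applyUpTo-cong _ _ d λ {i} _ → rightTerm i) (applyUpTo-∸ s d)
    shifted : suc (s + (y + d)) ≡ s + suc d + y
    shifted = trans (sym (+-suc s (y + d))) (trans (cong (s +_) (cong suc (+-comm y d))) (sym (+-assoc s (suc d) y)))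
    missing : suc (s + (y + d)) ∸ y ≡ s + suc d
    missing = trans (cong (_∸ y) shifted) (m+n∸n≡m (s + suc d) y)
    total : y + length ys + suc d ≡ y + d + suc (length ys)
    total = trans (+-assoc y _ _) (trans (cong (y +_) (trans (+-comm (length ys) (suc d)) (sym (+-suc d (length ys))))) (sym (+-assoc y d _)))

  rowHooks-↭ : ∀ x xs → Linked _≥_ (x ∷ xs) → rowHooks x xs ++ nonHooks x xs ↭ downTo 0 (x + length xs)
  rowHooks-↭ = ↭-downTo 0

  -- Splitting off the hook lengths of the first row.

  hookLengths : List ℕ → List ℕ
  hookLengths l = map (hook l) (boxes l)

  hook-here : ∀ x xs {j} → j < x → hook (x ∷ xs) (0 , j) ≡ (x ∸ j) + conjPart xs j
  hook-here x xs {j} j<x rewrite <⇒<ᵇ≡true j<x | +-suc (x ∸ j) (conjPart xs j) = refl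

  hook-there : ∀ z zs i {j} → j < z → hook (z ∷ zs) (suc i , j) ≡ hook zs (i , j)
  hook-there z zs i {j} j<z rewrite <⇒<ᵇ≡true j<z = refl

  -- `boxes` with arbitrary row indices: after the first row, `upTo` continues as `applyUpTo suc`,
  -- so an induction over rows cannot keep the indices fixed.
  boxesAt : (ℕ → ℕ) → List ℕ → List (ℕ × ℕ)
  boxesAt f xs = concat (map (λ p → map (λ j → (p .proj₁ , j)) (upTo (p .proj₂))) (zip (applyUpTo f (length xs)) xs))

  hooks-there : ∀ z zs f xs → Linked _≥_ (z ∷ xs) → map (hook (z ∷ zs)) (boxesAt (suc ∘ f) xs) ≡ map (hook zs) (boxesAt f xs)
  hooks-there z zs f []       l = refl
  hooks-there z zs f (x ∷ xs) l@(z≥x ∷ _) = begin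
    map (hook (z ∷ zs)) (map (suc (f 0) ,_) (upTo x) ++ boxesAt (suc ∘ f ∘ suc) xs)
      ≡⟨ map-++ (hook (z ∷ zs)) (map (suc (f 0) ,_) (upTo x)) _ ⟩
    map (hook (z ∷ zs)) (map (suc (f 0) ,_) (upTo x)) ++ map (hook (z ∷ zs)) (boxesAt (suc ∘ f ∘ suc) xs)
      ≡⟨ cong₂ _++_ row (hooks-there z zs (f ∘ suc) xs (Linked-skip l)) ⟩
    map (hook zs) (map (f 0 ,_) (upTo x)) ++ map (hook zs) (boxesAt (f ∘ suc) xs)
      ≡⟨ map-++ (hook zs) (map (f 0 ,_) (upTo x)) _ ⟨
    map (hook zs) (map (f 0 ,_) (upTo x) ++ boxesAt (f ∘ suc) xs) ∎
    where
    open ≡-Reasoning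
    row : map (hook (z ∷ zs)) (map (suc (f 0) ,_) (upTo x)) ≡ map (hook zs) (map (f 0 ,_) (upTo x))
    row = trans (map-map-upTo (hook (z ∷ zs)) (suc (f 0) ,_) x)
      (trans (applyUpTo-cong _ _ x λ j<x → hook-there z zs (f 0) (≤-trans j<x z≥x))
        (sym (map-map-upTo (hook zs) (f 0 ,_) x)))

  hookLengths-∷ : ∀ x xs → Linked _≥_ (x ∷ xs) → hookLengths (x ∷ xs) ≡ rowHooks x xs ++ hookLengths xs
  hookLengths-∷ x xs l = begin
    map (hook (x ∷ xs)) (map (0 ,_) (upTo x) ++ boxesAt suc xs)
      ≡⟨ map-++ (hook (x ∷ xs)) (map (0 ,_) (upTo x)) _ ⟩
    map (hook (x ∷ xs)) (map (0 ,_) (upTo x)) ++ map (hook (x ∷ xs)) (boxesAt suc xs)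
      ≡⟨ cong₂ _++_ (trans (map-map-upTo (hook (x ∷ xs)) (0 ,_) x) (applyUpTo-cong _ _ x (hook-here x xs))) (hooks-there x xs id xs l) ⟩
    rowHooks x xs ++ hookLengths xs ∎
    where open ≡-Reasoning

  -- Positivity, which later allows the non-hooks to be cancelled.
  product-nonHooks : ∀ n xs → Linked _≥_ (n ∷ xs) → ∃ λ d → product (nonHooks n xs) ≡ suc d
  product-nonHooks n []       l           = 0 , refl
  product-nonHooks n (y ∷ ys) l@(n≥y ∷ _) with product-nonHooks (suc n) ys (Linked-suc (Linked-skip l))
  ... | d , eq = d + (n ∸ y) * suc d , cong₂ _*_ (+-∸-assoc 1 n≥y) eq

module DPolynomials where
  open Hooks
  open import Data.Nat as ℕ using (ℕ; zero; suc; _≤_; _≥_; z≤n; s≤s; _∸_; _<ᵇ_)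
  import Data.Nat.Properties as ℕ
  open import Data.Nat.Tactic.RingSolver using (solve-∀)
  open import Data.Nat.ListAction using (sum; product)
  open import Data.Nat.ListAction.Properties using (sum-++; sum-↭; product-++; product-↭)
  import Data.Integer as ℤ
  import Data.Integer.Properties as ℤ
  open import Data.Bool using (true; false; T; if_then_else_)
  open import Data.List using (List; []; _∷_; _++_; map; length; drop)
  open import Data.List.Properties using (map-++; map-∘; map-cong-local)
  open import Data.List.Relation.Unary.All as All using (All; []; _∷_)
  import Data.List.Relation.Unary.All.Properties as All
  open import Data.List.Relation.Unary.Linked using (Linked; [-]; _∷_; tail)
  open import Data.List.Relation.Binary.Permutation.Propositional.Properties using (map⁺)
  open import Data.Product using (Σ; ∃; _×_; _,_; proj₁; proj₂)
  open import Data.Rational using (ℚ; 0ℚ; 1ℚ; _+_; _*_; _-_; -_; _/_; toℚᵘ)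
  open import Data.Rational.Properties as ℚ using (+-*-commutativeRing)
  open import Data.Rational.Solver using (module +-*-Solver)
  open import Data.Rational.Unnormalised as ℚᵘ using (mkℚᵘ; *≡*)
  import Data.Rational.Unnormalised.Properties as ℚᵘ
  open import Algebra.Bundles using (module CommutativeRing)
  open CommutativeRing +-*-commutativeRing using (semiring)
  open import Algebra.Properties.Semiring.Exp semiring using (_^_)
  open import Function using (_∘_)
  open import Relation.Nullary using (contradiction)
  open import Relation.Binary.PropositionalEquality hiding (J)
  open +-*-Solver using (solve; _:=_; _:+_; _:*_; _:-_; :-_; con)
  open ≡-Reasoning

  -- Recursive, so that `ι (suc n)` unfolds to `1ℚ + ι n` and the ring solver can deal with
  -- successors.
  ι : ℕ → ℚ
  ι zero    = 0ℚ
  ι (suc n) = 1ℚ + ι n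

  toℚᵘ-ι : ∀ n → toℚᵘ (ι n) ℚᵘ.≃ mkℚᵘ (ℤ.+ n) 0
  toℚᵘ-ι zero    = ℚᵘ.≃-refl
  toℚᵘ-ι (suc n) = ℚᵘ.≃-trans (ℚ.toℚᵘ-homo-+ 1ℚ (ι n))
    (ℚᵘ.≃-trans (ℚᵘ.+-congʳ (toℚᵘ 1ℚ) (toℚᵘ-ι n)) (*≡* (cong (λ m → (ℤ.+ 1 ℤ.+ m) ℤ.* ℤ.+ 1) (ℤ.*-identityʳ (ℤ.+ n)))))

  recip : ℕ → ℚ
  recip n = ℤ.+ 1 / suc n

  ι*recip : ∀ a d → ι a * recip d ≡ ℤ.+ a / suc d
  ι*recip a d = ℚ.toℚᵘ-injective
    (ℚᵘ.≃-trans (ℚ.toℚᵘ-homo-* (ι a) (recip d))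
    (ℚᵘ.≃-trans (ℚᵘ.*-cong (toℚᵘ-ι a) (ℚ.toℚᵘ-fromℚᵘ (mkℚᵘ (ℤ.+ 1) d)))
    (ℚᵘ.≃-trans (*≡* (cong₂ ℤ._*_ (ℤ.*-identityʳ (ℤ.+ a)) (sym (cong (λ m → ℤ.+ suc m) (ℕ.+-identityʳ d)))))
    (ℚᵘ.≃-sym (ℚ.toℚᵘ-fromℚᵘ (mkℚᵘ (ℤ.+ a) d))))))

  ι-recip : ∀ n → ι (suc n) * recip n ≡ 1ℚ
  ι-recip n = trans (ι*recip (suc n) n) (ℚ.toℚᵘ-injective
    (ℚᵘ.≃-trans (ℚ.toℚᵘ-fromℚᵘ (mkℚᵘ (ℤ.+ suc n) n)) (*≡* (ℤ.*-comm (ℤ.+ suc n) (ℤ.+ 1)))))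

  ι-cancel : ∀ d {x y} → x * ι (suc d) ≡ y * ι (suc d) → x ≡ y
  ι-cancel d {x} {y} eq = begin
    x                         ≡⟨ undo x ⟩
    x * ι (suc d) * recip d   ≡⟨ cong (_* recip d) eq ⟩
    y * ι (suc d) * recip d   ≡⟨ undo y ⟨
    y                         ∎
    where
    undo : ∀ x → x ≡ x * ι (suc d) * recip d
    undo x = sym (trans (ℚ.*-assoc x _ _) (trans (cong (x *_) (ι-recip d)) (ℚ.*-identityʳ x)))

  ι-+ : ∀ m n → ι (m ℕ.+ n) ≡ ι m + ι n
  ι-+ zero    n = sym (ℚ.+-identityˡ _)
  ι-+ (suc m) n = trans (cong (_+_ 1ℚ) (ι-+ m n)) (sym (ℚ.+-assoc 1ℚ (ι m) (ι n)))

  ι-* : ∀ m n → ι (m ℕ.* n) ≡ ι m * ι n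
  ι-* zero    n = sym (ℚ.*-zeroˡ (ι n))
  ι-* (suc m) n = trans (ι-+ n (m ℕ.* n)) (trans (cong (_+_ (ι n)) (ι-* m n))
    (solve 2 (λ m n → n :+ m :* n := (con 1ℚ :+ m) :* n) refl (ι m) (ι n)))

  ι-∸ : ∀ {m n} → m ≤ n → ι (n ℕ.∸ m) ≡ ι n - ι m
  ι-∸ {_} {n} z≤n             = solve 1 (λ n → n := n :- con 0ℚ) refl (ι n)
  ι-∸ (s≤s {m} {n} m≤n) = trans (ι-∸ m≤n)
    (solve 2 (λ m n → n :- m := (con 1ℚ :+ n) :- (con 1ℚ :+ m)) refl (ι m) (ι n))

  -- Adding a box, and sums over all additions.

  -- Add o l c μ: μ arises from l by adding a box of content c, where o is the
  -- content of the first box of l.  The new row need not be shorter than the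
  -- previous one; such μ will get weight zero.
  data Add : ℚ → List ℕ → ℚ → List ℕ → Set where
    new   : ∀ {o} → Add o [] o (1 ∷ [])
    here  : ∀ {o x xs} → Add o (x ∷ xs) (ι x + o) (suc x ∷ xs)
    there : ∀ {o x xs c μ} → Add (o - 1ℚ) xs c μ → Add o (x ∷ xs) c (x ∷ μ)

  Sum : ℚ → List ℕ → (ℚ → List ℕ → ℚ) → ℚ
  Sum o []       φ = φ o (1 ∷ [])
  Sum o (x ∷ xs) φ = φ (ι x + o) (suc x ∷ xs) + Sum (o - 1ℚ) xs (λ c μ → φ c (x ∷ μ))

  Sum-cong : ∀ {o} l {φ ψ} → (∀ {c μ} → Add o l c μ → φ c μ ≡ ψ c μ) → Sum o l φ ≡ Sum o l ψ
  Sum-cong []       eq = eq new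
  Sum-cong (x ∷ xs) eq = cong₂ _+_ (eq here) (Sum-cong xs λ a → eq (there a))

  Sum-+ : ∀ {o} l φ ψ → Sum o l (λ c μ → φ c μ + ψ c μ) ≡ Sum o l φ + Sum o l ψ
  Sum-+ []       φ ψ = refl
  Sum-+ (x ∷ xs) φ ψ = trans (cong (_+_ (φ _ _ + ψ _ _)) (Sum-+ xs φ′ ψ′))
    (solve 4 (λ a b c d → (a :+ b) :+ (c :+ d) := (a :+ c) :+ (b :+ d)) refl (φ _ _) (ψ _ _) (Sum _ xs φ′) (Sum _ xs ψ′))
    where
    φ′ ψ′ : ℚ → List ℕ → ℚ
    φ′ c μ = φ c (x ∷ μ)
    ψ′ c μ = ψ c (x ∷ μ)

  Sum-* : ∀ {o} l a φ → Sum o l (λ c μ → a * φ c μ) ≡ a * Sum o l φ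
  Sum-* []       a φ = refl
  Sum-* (x ∷ xs) a φ = trans (cong (_+_ (a * φ _ _)) (Sum-* xs a φ′)) (sym (ℚ.*-distribˡ-+ a (φ _ _) (Sum _ xs φ′)))
    where
    φ′ : ℚ → List ℕ → ℚ
    φ′ c μ = φ c (x ∷ μ)

  -- Inverse hook products and the total transition weight.

  invfact : ℕ → ℚ
  invfact zero    = 1ℚ
  invfact (suc n) = invfact n * recip n

  -- k x xs is the inverse of the product of the hook lengths in a row of length
  -- x placed on top of xs.  With l_i = λ_i + ℓ - i it is ∏_{j>i} (l_i - l_j) / l_i!.
  k : ℕ → List ℕ → ℚ
  k n []       = invfact n
  k n (y ∷ ys) = (ι (suc n) - ι y) * k (suc n) ys

  K : List ℕ → ℚ
  K []       = 1ℚ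
  K (x ∷ xs) = k x xs * K xs

  -- Content of the first free box in a row of length n on top of xs, minus c.
  gap : ℕ → ℚ → ℚ → ℚ
  gap n o c = ι (suc n) + o - c

  gap-there : ∀ n o c → gap (suc n) (o - 1ℚ) c ≡ gap n o c
  gap-there n o c = solve 3 (λ n o c → (con 1ℚ :+ (con 1ℚ :+ n)) :+ (o :- con 1ℚ) :- c := con 1ℚ :+ n :+ o :- c)
    refl (ι n) o c

  gap-here : ∀ n o y → gap n o (ι y + o) ≡ ι (suc n) - ι y
  gap-here n o y = solve 3 (λ n o y → n :+ o :- (y :+ o) := n :- y) refl (ι (suc n)) o (ι y)

  gap-new : ∀ n o → gap n o o ≡ ι (suc n)
  gap-new n o = solve 2 (λ n o → n :+ o :- o := n) refl (ι (suc n)) o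

  gap-pos : ∀ {o xs c μ} → Add o xs c μ → ∀ {n} → Linked _≥_ (n ∷ xs) → ∃ λ d → gap n o c ≡ ι (suc d)
  gap-pos {o} new {n} _ = n , gap-new n o
  gap-pos {o} (here {x = y}) {n} (n≥y ∷ _) = n ℕ.∸ y , (begin
    gap n o (ι y + o)   ≡⟨ gap-here n o y ⟩
    1ℚ + ι n - ι y      ≡⟨ ℚ.+-assoc 1ℚ (ι n) (- ι y) ⟩
    1ℚ + (ι n - ι y)    ≡⟨ cong (_+_ 1ℚ) (ι-∸ n≥y) ⟨
    ι (suc (n ℕ.∸ y))   ∎)
  gap-pos {o} {c = c} (there a) {n} l with gap-pos a (Linked-suc (Linked-skip l))
  ... | d , eq = d , trans (sym (gap-there n o c)) eq

  -- For a genuine addition exactly one hook of the upper row grows, namely the one in the column of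
  -- the new box, from `gap n o c - 1ℚ` to `gap n o c`. If the gap is 1, the new box overhangs the
  -- row and the formula gives 0.
  k-add : ∀ {o xs c μ} → Add o xs c μ → ∀ n → k n μ * gap n o c ≡ k n xs * (gap n o c - 1ℚ)
  k-add {o} new n = begin
    (ι (suc n) - 1ℚ) * (invfact n * recip n) * gap n o o  ≡⟨ cong ((ι (suc n) - 1ℚ) * (invfact n * recip n) *_) (gap-new n o) ⟩
    (ι (suc n) - 1ℚ) * (invfact n * recip n) * ι (suc n)
      ≡⟨ solve 3 (λ s f r → (s :- con 1ℚ) :* (f :* r) :* s := f :* (s :- con 1ℚ) :* (s :* r)) refl (ι (suc n)) (invfact n) (recip n) ⟩
    invfact n * (ι (suc n) - 1ℚ) * (ι (suc n) * recip n)  ≡⟨ cong (invfact n * (ι (suc n) - 1ℚ) *_) (ι-recip n) ⟩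
    invfact n * (ι (suc n) - 1ℚ) * 1ℚ                     ≡⟨ ℚ.*-identityʳ _ ⟩
    invfact n * (ι (suc n) - 1ℚ)                          ≡⟨ cong (λ g → invfact n * (g - 1ℚ)) (gap-new n o) ⟨
    invfact n * (gap n o o - 1ℚ)                          ∎
  k-add {o} (here {x = y} {xs}) n =
    solve 4 (λ n o y r → ((con 1ℚ :+ n) :- (con 1ℚ :+ y)) :* r :* (con 1ℚ :+ n :+ o :- (y :+ o))
                       := ((con 1ℚ :+ n) :- y) :* r :* (con 1ℚ :+ n :+ o :- (y :+ o) :- con 1ℚ))
      refl (ι n) o (ι y) (k (suc n) xs)
  k-add {o} {y ∷ ys} {c} {_ ∷ μ} (there a) n = begin
    e * k (suc n) μ * gap n o c          ≡⟨ ℚ.*-assoc e _ _ ⟩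
    e * (k (suc n) μ * gap n o c)        ≡⟨ cong (e *_) (subst (λ g → k (suc n) μ * g ≡ k (suc n) ys * (g - 1ℚ)) (gap-there n o c) (k-add a (suc n))) ⟩
    e * (k (suc n) ys * (gap n o c - 1ℚ)) ≡⟨ ℚ.*-assoc e _ _ ⟨
    e * k (suc n) ys * (gap n o c - 1ℚ)  ∎
    where e = ι (suc n) - ι y

  -- Partial fractions: with A′ = A (1 - 1/p) and B′ = B (1 - 1/q), the product
  -- 1/(p q) is split by (p - q) / (p q) = 1/q - 1/p.
  split : ∀ {A A′ B B′ p q} i j → p ≡ ι (suc i) → q ≡ ι (suc j) →
    A′ * p ≡ A * (p - 1ℚ) → B′ * q ≡ B * (q - 1ℚ) →
    (p - q) * (A′ * B′) ≡ (p - q + 1ℚ) * (A′ * B) + ((p - q - 1ℚ) * (A * B′) + (- ((p - q) * (A * B))))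
  split {A} {A′} {B} {B′} {p} {q} i j refl refl eA eB = ι-cancel i (ι-cancel j (begin
    (p - q) * (A′ * B′) * p * q
      ≡⟨ solve 4 (λ A B p q → (p :- q) :* (A :* B) :* p :* q := (p :- q) :* ((A :* p) :* (B :* q))) refl A′ B′ p q ⟩
    (p - q) * ((A′ * p) * (B′ * q))
      ≡⟨ cong₂ (λ a b → (p - q) * (a * b)) eA eB ⟩
    (p - q) * ((A * (p - 1ℚ)) * (B * (q - 1ℚ)))
      ≡⟨ solve 4 (λ A B p q → let 1′ = con 1ℚ in (p :- q) :* ((A :* (p :- 1′)) :* (B :* (q :- 1′)))
           := (p :- q :+ 1′) :* ((A :* (p :- 1′)) :* (B :* q))
              :+ ((p :- q :- 1′) :* ((A :* p) :* (B :* (q :- 1′))) :+ (:- ((p :- q) :* ((A :* p) :* (B :* q)))))) refl A B p q ⟩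
    (p - q + 1ℚ) * ((A * (p - 1ℚ)) * (B * q)) + ((p - q - 1ℚ) * ((A * p) * (B * (q - 1ℚ))) + (- ((p - q) * ((A * p) * (B * q)))))
      ≡⟨ cong₂ (λ a b → (p - q + 1ℚ) * (a * (B * q)) + ((p - q - 1ℚ) * ((A * p) * b) + (- ((p - q) * ((A * p) * (B * q)))))) eA eB ⟨
    (p - q + 1ℚ) * ((A′ * p) * (B * q)) + ((p - q - 1ℚ) * ((A * p) * (B′ * q)) + (- ((p - q) * ((A * p) * (B * q)))))
      ≡⟨ solve 6 (λ A A′ B B′ p q → let 1′ = con 1ℚ in
              (p :- q :+ 1′) :* ((A′ :* p) :* (B :* q)) :+ ((p :- q :- 1′) :* ((A :* p) :* (B′ :* q)) :+ (:- ((p :- q) :* ((A :* p) :* (B :* q)))))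
           := ((p :- q :+ 1′) :* (A′ :* B) :+ ((p :- q :- 1′) :* (A :* B′) :+ (:- ((p :- q) :* (A :* B))))) :* p :* q) refl A A′ B B′ p q ⟩
    ((p - q + 1ℚ) * (A′ * B) + ((p - q - 1ℚ) * (A * B′) + (- ((p - q) * (A * B))))) * p * q ∎))

  -- The transition weights H_λ / H_λ⁺ add up to 1. A box added below the first row `x` also changes
  -- `k x`, so the induction needs sums with one further factor `k n`.
  Sum-K : ∀ o xs → Linked _≥_ xs → Sum o xs (λ _ μ → K μ) ≡ K xs
  -- This is `Sum-K` for `n ∷ xs`, with the term of the first row moved to the other side. For
  -- `y ∷ ys` the summand contains both `k y μ` and `k (suc n) μ`; `split` replaces their product by
  -- terms with at most one of them, to which the induction applies.
  Sum-Kk : ∀ o xs n → Linked _≥_ (n ∷ xs) →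
    Sum o xs (λ _ μ → K μ * k n μ) ≡ K xs * (k n xs - k (suc n) xs)

  Sum-K o []       _ = refl
  Sum-K o (x ∷ xs) l = begin
    k (suc x) xs * K xs + Sum (o - 1ℚ) xs (λ _ μ → k x μ * K μ)
      ≡⟨ cong (_+_ (k (suc x) xs * K xs)) (trans (Sum-cong xs λ {_} {μ} _ → ℚ.*-comm (k x μ) (K μ)) (Sum-Kk (o - 1ℚ) xs x l)) ⟩
    k (suc x) xs * K xs + K xs * (k x xs - k (suc x) xs)
      ≡⟨ solve 3 (λ a b c → a :* b :+ b :* (c :- a) := c :* b) refl (k (suc x) xs) (K xs) (k x xs) ⟩
    k x xs * K xs ∎

  Sum-Kk o [] n _ = begin
    1ℚ * ((1ℚ + ι n - 1ℚ) * (f * r))   ≡⟨ solve 3 (λ n f r → con 1ℚ :* ((con 1ℚ :+ n :- con 1ℚ) :* (f :* r)) := con 1ℚ :* (f :* ((con 1ℚ :+ n) :* r) :- f :* r)) refl (ι n) f r ⟩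
    1ℚ * (f * (ι (suc n) * r) - f * r) ≡⟨ cong (λ u → 1ℚ * (f * u - f * r)) (ι-recip n) ⟩
    1ℚ * (f * 1ℚ - f * r)              ≡⟨ cong (λ u → 1ℚ * (u - f * r)) (ℚ.*-identityʳ f) ⟩
    1ℚ * (f - f * r)                   ∎
    where f = invfact n
          r = recip n
  Sum-Kk o (y ∷ ys) n l@(n≥y ∷ lys) = begin
    k (suc y) ys * K ys * ((ι (suc n) - ι (suc y)) * A) + Sum (o - 1ℚ) ys (λ c μ → k y μ * K μ * (d * k (suc n) μ))
      ≡⟨ cong (k (suc y) ys * K ys * ((ι (suc n) - ι (suc y)) * A) +_) (trans (Sum-cong ys term)
        (trans (Sum-+ ys (λ _ μ → (d + 1ℚ) * B * (K μ * k (suc n) μ)) (λ _ μ → (d - 1ℚ) * A * (K μ * k y μ) + (- (d * (A * B))) * K μ))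
        (cong₂ _+_
          (trans (Sum-* ys ((d + 1ℚ) * B) _) (cong ((d + 1ℚ) * B *_) (Sum-Kk (o - 1ℚ) ys (suc n) (Linked-suc (Linked-skip l)))))
          (trans (Sum-+ ys (λ _ μ → (d - 1ℚ) * A * (K μ * k y μ)) (λ _ μ → (- (d * (A * B))) * K μ)) (cong₂ _+_
            (trans (Sum-* ys ((d - 1ℚ) * A) _) (cong ((d - 1ℚ) * A *_) (Sum-Kk (o - 1ℚ) ys y lys)))
            (trans (Sum-* ys (- (d * (A * B))) _) (cong ((- (d * (A * B))) *_) (Sum-K (o - 1ℚ) ys (tail lys))))))))) ⟩
    k (suc y) ys * K ys * ((ι (suc n) - ι (suc y)) * A)
      + ((d + 1ℚ) * B * (K ys * (A - A⁺)) + ((d - 1ℚ) * A * (K ys * (B - B⁺)) + (- (d * (A * B))) * K ys))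
      ≡⟨ solve 7 (λ n y A A⁺ B B⁺ κ → let 1′ = con 1ℚ; d = (1′ :+ n) :- y in
           B⁺ :* κ :* ((1′ :+ n :- (1′ :+ y)) :* A)
             :+ ((d :+ 1′) :* B :* (κ :* (A :- A⁺)) :+ ((d :- 1′) :* A :* (κ :* (B :- B⁺)) :+ (:- (d :* (A :* B))) :* κ))
           := B :* κ :* (d :* A :- (1′ :+ (1′ :+ n) :- y) :* A⁺))
           refl (ι n) (ι y) A A⁺ B B⁺ (K ys) ⟩
    k y ys * K ys * (d * A - (ι (suc (suc n)) - ι y) * A⁺) ∎
    where
    d = ι (suc n) - ι y
    A = k (suc n) ys
    A⁺ = k (suc (suc n)) ys
    B = k y ys
    B⁺ = k (suc y) ys
    term : ∀ {c μ} → Add (o - 1ℚ) ys c μ → k y μ * K μ * (d * k (suc n) μ)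
         ≡ (d + 1ℚ) * B * (K μ * k (suc n) μ) + ((d - 1ℚ) * A * (K μ * k y μ) + (- (d * (A * B))) * K μ)
    term {c} {μ} a = begin
      B′ * κ * (d * A′)         ≡⟨ solve 4 (λ A B d κ → B :* κ :* (d :* A) := κ :* (d :* (A :* B))) refl A′ B′ d κ ⟩
      κ * (d * (A′ * B′))       ≡⟨ cong (κ *_) (subst (λ d → d * (A′ * B′) ≡ (d + 1ℚ) * (A′ * B) + ((d - 1ℚ) * (A * B′) + (- (d * (A * B))))) p-q≡d
                                    (split {A} {A′} {B} {B′} (proj₁ p>0) (proj₁ q>0) (proj₂ p>0) (proj₂ q>0) (k-add a (suc n)) (k-add a y))) ⟩
      κ * ((d + 1ℚ) * (A′ * B) + ((d - 1ℚ) * (A * B′) + (- (d * (A * B)))))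
        ≡⟨ solve 6 (λ A A′ B B′ d κ → let 1′ = con 1ℚ in κ :* ((d :+ 1′) :* (A′ :* B) :+ ((d :- 1′) :* (A :* B′) :+ (:- (d :* (A :* B)))))
             := (d :+ 1′) :* B :* (κ :* A′) :+ ((d :- 1′) :* A :* (κ :* B′) :+ (:- (d :* (A :* B))) :* κ)) refl A A′ B B′ d κ ⟩
      (d + 1ℚ) * B * (κ * A′) + ((d - 1ℚ) * A * (κ * B′) + (- (d * (A * B))) * κ) ∎
      where
      κ = K μ
      A′ = k (suc n) μ
      B′ = k y μ
      p>0 = gap-pos a (Linked-suc (Linked-skip l))
      q>0 = gap-pos a lys
      -- The content `c` cancels in the difference of the gaps, so the coefficients of the partial
      -- fractions do not depend on the added box and can leave the sum.
      p-q≡d : gap (suc n) (o - 1ℚ) c - gap y (o - 1ℚ) c ≡ d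
      p-q≡d = solve 4 (λ n y o c → let 1′ = con 1ℚ in (1′ :+ (1′ :+ n) :+ o :- c) :- (1′ :+ y :+ o :- c) := 1′ :+ n :- y)
        refl (ι n) (ι y) (o - 1ℚ) c

  -- Moments of the content under the transition weights.

  -- ∑ M o l m t^m = ∏ (1 - y t) / ∏ (1 - x t) with the contents x of the addable
  -- and y of the removable boxes; here each row contributes one factor to
  -- both products, before cancellation.
  M : ℚ → List ℕ → ℕ → ℚ
  M o []       m       = o ^ m
  M o (x ∷ xs) zero    = 1ℚ
  M o (x ∷ xs) (suc m) = (ι x + o) * M o (x ∷ xs) m + (M (o - 1ℚ) xs (suc m) - (ι x + o - 1ℚ) * M (o - 1ℚ) xs m)

  M-zero : ∀ o xs → M o xs 0 ≡ 1ℚ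
  M-zero o []       = refl
  M-zero o (x ∷ xs) = refl

  -- With `a = ι x + o`, the gap of the first row is `a - c`, and `k-add` turns `c * k x μ` into
  -- `a * k x μ + k x xs * (c - (a - 1ℚ))`. One factor `c` is thus traded for `a` and for moments of
  -- the lower rows, which is the recursion of `M`. For the addition to the first row, `c` is `a`
  -- itself.
  Sum-moment : ∀ o xs → Linked _≥_ xs → ∀ m → Sum o xs (λ c μ → K μ * c ^ m) ≡ K xs * M o xs m
  Sum-moment o xs l zero = begin
    Sum o xs (λ c μ → K μ * 1ℚ) ≡⟨ Sum-cong xs (λ {_} {μ} _ → ℚ.*-identityʳ (K μ)) ⟩
    Sum o xs (λ c μ → K μ)      ≡⟨ Sum-K o xs l ⟩
    K xs                        ≡⟨ ℚ.*-identityʳ _ ⟨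
    K xs * 1ℚ                   ≡⟨ cong (K xs *_) (M-zero o xs) ⟨
    K xs * M o xs 0             ∎
  Sum-moment o []       l (suc m) = refl
  Sum-moment o (x ∷ xs) l (suc m) = begin
    h * (a * a ^ m) + Sum (o - 1ℚ) xs (λ c μ → k x μ * K μ * (c * c ^ m))
      ≡⟨ cong (_+_ (h * (a * a ^ m))) (trans (Sum-cong xs term)
         (trans (Sum-+ xs (λ c μ → a * φ m c (x ∷ μ)) (λ c μ → k x xs * (φ (suc m) c μ + (- (a - 1ℚ)) * φ m c μ)))
         (cong₂ _+_ (Sum-* xs a λ c μ → φ m c (x ∷ μ)) (trans (Sum-* xs (k x xs) (λ c μ → φ (suc m) c μ + (- (a - 1ℚ)) * φ m c μ))
           (cong (k x xs *_) (trans (Sum-+ xs (φ (suc m)) (λ c μ → (- (a - 1ℚ)) * φ m c μ)) (cong₂ _+_ (Sum-moment (o - 1ℚ) xs (tail l) (suc m))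
             (trans (Sum-* xs (- (a - 1ℚ)) (φ m)) (cong (- (a - 1ℚ) *_) (Sum-moment (o - 1ℚ) xs (tail l) m)))))))))) ⟩
    h * (a * a ^ m) + (a * s + k x xs * (K xs * M₁ + (- (a - 1ℚ)) * (K xs * M₀)))
      ≡⟨ solve 8 (λ h a am s κ K M₁ M₀ → h :* (a :* am) :+ (a :* s :+ κ :* (K :* M₁ :+ (:- (a :- con 1ℚ)) :* (K :* M₀)))
             := a :* (h :* am :+ s) :+ κ :* K :* (M₁ :- (a :- con 1ℚ) :* M₀)) refl h a (a ^ m) s (k x xs) (K xs) M₁ M₀ ⟩
    a * (h * a ^ m + s) + k x xs * K xs * (M₁ - (a - 1ℚ) * M₀)
      ≡⟨ cong (λ t → a * t + k x xs * K xs * (M₁ - (a - 1ℚ) * M₀)) (Sum-moment o (x ∷ xs) l m) ⟩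
    a * (k x xs * K xs * M o (x ∷ xs) m) + k x xs * K xs * (M₁ - (a - 1ℚ) * M₀)
      ≡⟨ solve 4 (λ a κ M N → a :* (κ :* M) :+ κ :* N := κ :* (a :* M :+ N)) refl a (k x xs * K xs) (M o (x ∷ xs) m) _ ⟩
    k x xs * K xs * (a * M o (x ∷ xs) m + (M₁ - (a - 1ℚ) * M₀)) ∎
    where
    a = ι x + o
    φ : ℕ → ℚ → List ℕ → ℚ
    φ m c μ = K μ * c ^ m
    h = k (suc x) xs * K xs
    s = Sum (o - 1ℚ) xs (λ c μ → k x μ * K μ * c ^ m)
    M₁ = M (o - 1ℚ) xs (suc m)
    M₀ = M (o - 1ℚ) xs m
    term : ∀ {c μ} → Add (o - 1ℚ) xs c μ → k x μ * K μ * (c * c ^ m)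
         ≡ a * (k x μ * K μ * c ^ m) + k x xs * (K μ * (c * c ^ m) + (- (a - 1ℚ)) * (K μ * c ^ m))
    term {c} {μ} ad = begin
      B′ * κ * (c * e)
        ≡⟨ solve 6 (λ c x o e B′ κ → let g = con 1ℚ :+ x :+ (o :- con 1ℚ) :- c in
             B′ :* κ :* (c :* e) := (x :+ o) :* (B′ :* κ :* e) :+ (:- (B′ :* g)) :* κ :* e) refl c (ι x) o e B′ κ ⟩
      a * (B′ * κ * e) + (- (B′ * gap x (o - 1ℚ) c)) * κ * e
        ≡⟨ cong (λ t → a * (B′ * κ * e) + (- t) * κ * e) (k-add ad x) ⟩
      a * (B′ * κ * e) + (- (k x xs * (gap x (o - 1ℚ) c - 1ℚ))) * κ * e
        ≡⟨ solve 7 (λ c x o e B′ B κ → let g = con 1ℚ :+ x :+ (o :- con 1ℚ) :- c; a = x :+ o in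
             a :* (B′ :* κ :* e) :+ (:- (B :* (g :- con 1ℚ))) :* κ :* e
             := a :* (B′ :* κ :* e) :+ B :* (κ :* (c :* e) :+ (:- (a :- con 1ℚ)) :* (κ :* e))) refl c (ι x) o e B′ (k x xs) κ ⟩
      a * (B′ * κ * e) + k x xs * (κ * (c * e) + (- (a - 1ℚ)) * (κ * e)) ∎
      where
      κ = K μ
      e = c ^ m
      B′ = k x μ

  -- Multiplication of the power series ∑ s m t^m by 1 - a t.
  mul : ℚ → (ℕ → ℚ) → ℕ → ℚ
  mul a s zero    = s 0
  mul a s (suc m) = s (suc m) - a * s m

  mul-cong : ∀ {a b} {s t : ℕ → ℚ} → a ≡ b → s ≗ t → mul a s ≗ mul b t
  mul-cong refl eq zero    = eq 0
  mul-cong {a} refl eq (suc m) = cong₂ (λ x y → x - a * y) (eq (suc m)) (eq m)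

  mul-comm : ∀ a b s → mul a (mul b s) ≗ mul b (mul a s)
  mul-comm a b s zero          = refl
  mul-comm a b s (suc zero)    = solve 4 (λ a b x y → x :- b :* y :- a :* y := x :- a :* y :- b :* y)
    refl a b (s 1) (s 0)
  mul-comm a b s (suc (suc m)) = solve 5 (λ a b x y z → x :- b :* y :- a :* (y :- b :* z) := x :- a :* y :- b :* (y :- a :* z))
    refl a b (s (suc (suc m))) (s (suc m)) (s m)

  -- The constant term of `1 - a t` is 1, so the coefficients can be recovered one after another.
  mul-injective : ∀ a {s t} → mul a s ≗ mul a t → s ≗ t
  mul-injective a         eq zero    = eq 0
  mul-injective a {s} {t} eq (suc m) = begin
    s (suc m)                       ≡⟨ undo s ⟩
    s (suc m) - a * s m + a * s m   ≡⟨ cong₂ (λ x y → x + a * y) (eq (suc m)) (mul-injective a eq m) ⟩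
    t (suc m) - a * t m + a * t m   ≡⟨ undo t ⟨
    t (suc m)                       ∎
    where
    undo : ∀ s → s (suc m) ≡ s (suc m) - a * s m + a * s m
    undo s = solve 2 (λ x y → x := x :- y :+ y) refl (s (suc m)) (a * s m)

  M-mul : ∀ o x xs → mul (ι x + o) (M o (x ∷ xs)) ≗ mul (ι x + o - 1ℚ) (M (o - 1ℚ) xs)
  M-mul o x xs zero    = sym (M-zero (o - 1ℚ) xs)
  M-mul o x xs (suc m) = solve 2 (λ p q → p :+ q :- p := q) refl ((ι x + o) * M o (x ∷ xs) m) _

  -- Without rows `M` is a geometric series, so both sides are the series 1. This lets a new row be
  -- treated as an empty row that grows.
  M[]-mul : ∀ a b → mul a (M a []) ≗ mul b (M b [])
  M[]-mul a b zero    = refl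
  M[]-mul a b (suc m) = solve 2 (λ x y → x :- x := y :- y) refl (a * a ^ m) (b * b ^ m)

  -- The growing row has its factor (1 - (c - 1) t) / (1 - c t) replaced by (1 - c t) / (1 - (c + 1)
  -- t), and the other factors stay. Cross-multiplication avoids division of series; in a lower row,
  -- the denominator of the top row is multiplied in and cancelled by `mul-injective`.
  M-add : ∀ {o l c μ} → Add o l c μ →
    mul (c + 1ℚ) (mul (c - 1ℚ) (M o μ)) ≗ mul c (mul c (M o l))
  M-add {o} new m = begin
    mul (o + 1ℚ) (mul (o - 1ℚ) (M o (1 ∷ []))) m           ≡⟨ mul-comm (o + 1ℚ) (o - 1ℚ) (M o (1 ∷ [])) m ⟩
    mul (o - 1ℚ) (mul (o + 1ℚ) (M o (1 ∷ []))) m           ≡⟨ mul-cong refl (mul-cong (ℚ.+-comm o 1ℚ) λ _ → refl) m ⟩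
    mul (o - 1ℚ) (mul (ι 1 + o) (M o (1 ∷ []))) m          ≡⟨ mul-cong refl (M-mul o 1 []) m ⟩
    mul (o - 1ℚ) (mul (1ℚ + o - 1ℚ) (M (o - 1ℚ) [])) m
      ≡⟨ mul-cong refl (mul-cong (solve 1 (λ o → con 1ℚ :+ o :- con 1ℚ := o) refl o) λ _ → refl) m ⟩
    mul (o - 1ℚ) (mul o (M (o - 1ℚ) [])) m                 ≡⟨ mul-comm (o - 1ℚ) o (M (o - 1ℚ) []) m ⟩
    mul o (mul (o - 1ℚ) (M (o - 1ℚ) [])) m                 ≡⟨ mul-cong refl (M[]-mul (o - 1ℚ) o) m ⟩
    mul o (mul o (M o [])) m                               ∎
  M-add {o} (here {x = x} {xs}) m = begin
    mul (c + 1ℚ) (mul (c - 1ℚ) (M o (suc x ∷ xs))) m       ≡⟨ mul-comm (c + 1ℚ) (c - 1ℚ) (M o (suc x ∷ xs)) m ⟩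
    mul (c - 1ℚ) (mul (c + 1ℚ) (M o (suc x ∷ xs))) m
      ≡⟨ mul-cong refl (mul-cong (solve 2 (λ x o → x :+ o :+ con 1ℚ := con 1ℚ :+ x :+ o) refl (ι x) o) λ _ → refl) m ⟩
    mul (c - 1ℚ) (mul (ι (suc x) + o) (M o (suc x ∷ xs))) m ≡⟨ mul-cong refl (M-mul o (suc x) xs) m ⟩
    mul (c - 1ℚ) (mul (ι (suc x) + o - 1ℚ) (M (o - 1ℚ) xs)) m
      ≡⟨ mul-cong refl (mul-cong (solve 2 (λ x o → con 1ℚ :+ x :+ o :- con 1ℚ := x :+ o) refl (ι x) o) λ _ → refl) m ⟩
    mul (c - 1ℚ) (mul c (M (o - 1ℚ) xs)) m                 ≡⟨ mul-comm (c - 1ℚ) c (M (o - 1ℚ) xs) m ⟩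
    mul c (mul (c - 1ℚ) (M (o - 1ℚ) xs)) m                 ≡⟨ mul-cong refl (M-mul o x xs) m ⟨
    mul c (mul c (M o (x ∷ xs))) m                         ∎
    where c = ι x + o
  M-add {o} {x ∷ xs} {c} {_ ∷ μ} (there ad) = mul-injective a λ m → begin
    mul a (mul (c + 1ℚ) (mul (c - 1ℚ) (M o (x ∷ μ)))) m    ≡⟨ mul-comm a (c + 1ℚ) (mul (c - 1ℚ) (M o (x ∷ μ))) m ⟩
    mul (c + 1ℚ) (mul a (mul (c - 1ℚ) (M o (x ∷ μ)))) m    ≡⟨ mul-cong refl (mul-comm a (c - 1ℚ) (M o (x ∷ μ))) m ⟩
    mul (c + 1ℚ) (mul (c - 1ℚ) (mul a (M o (x ∷ μ)))) m    ≡⟨ mul-cong refl (mul-cong refl (M-mul o x μ)) m ⟩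
    mul (c + 1ℚ) (mul (c - 1ℚ) (mul b (M (o - 1ℚ) μ))) m   ≡⟨ mul-cong refl (mul-comm b (c - 1ℚ) (M (o - 1ℚ) μ)) m ⟨
    mul (c + 1ℚ) (mul b (mul (c - 1ℚ) (M (o - 1ℚ) μ))) m   ≡⟨ mul-comm b (c + 1ℚ) (mul (c - 1ℚ) (M (o - 1ℚ) μ)) m ⟨
    mul b (mul (c + 1ℚ) (mul (c - 1ℚ) (M (o - 1ℚ) μ))) m   ≡⟨ mul-cong refl (M-add ad) m ⟩
    mul b (mul c (mul c (M (o - 1ℚ) xs))) m                ≡⟨ mul-comm b c (mul c (M (o - 1ℚ) xs)) m ⟩
    mul c (mul b (mul c (M (o - 1ℚ) xs))) m                ≡⟨ mul-cong refl (mul-comm b c (M (o - 1ℚ) xs)) m ⟩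
    mul c (mul c (mul b (M (o - 1ℚ) xs))) m                ≡⟨ mul-cong refl (mul-cong refl (M-mul o x xs)) m ⟨
    mul c (mul c (mul a (M o (x ∷ xs)))) m                 ≡⟨ mul-cong refl (mul-comm a c (M o (x ∷ xs))) m ⟨
    mul c (mul a (mul c (M o (x ∷ xs)))) m                 ≡⟨ mul-comm a c (mul c (M o (x ∷ xs))) m ⟨
    mul a (mul c (mul c (M o (x ∷ xs)))) m                 ∎
    where
    a = ι x + o
    b = a - 1ℚ

  -- The solution of (1 - (c + 1) t) (1 - (c - 1) t) u(t) = t² e(t).
  rec : (ℕ → ℚ) → ℚ → ℕ → ℚ
  rec e c 0             = 0ℚ
  rec e c 1             = 0ℚ
  rec e c (suc (suc m)) = (c + c) * rec e c (suc m) + ((1ℚ - c * c) * rec e c m + e m)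

  -- In `M-add` the two quadratic factors differ by t², so the increment solves the equation of
  -- `rec` with `M o l` itself as source.
  M-increment : ∀ {o l c μ} → Add o l c μ → ∀ m → M o μ m ≡ M o l m + rec (M o l) c m
  M-increment a zero = trans (M-add a 0) (sym (ℚ.+-identityʳ _))
  M-increment {o} {l} {c} {μ} a (suc zero) = begin
    M o μ 1 ≡⟨ solve 3 (λ c x y → x := x :- (c :- con 1ℚ) :* y :- (c :+ con 1ℚ) :* y :+ (c :+ c) :* y) refl c (M o μ 1) (M o μ 0) ⟩
    mul (c + 1ℚ) (mul (c - 1ℚ) (M o μ)) 1 + (c + c) * M o μ 0 ≡⟨ cong₂ (λ p q → p + (c + c) * q) (M-add a 1) (M-add a 0) ⟩
    mul c (mul c (M o l)) 1 + (c + c) * M o l 0 ≡⟨ solve 3 (λ c x y → x :- c :* y :- c :* y :+ (c :+ c) :* y := x :+ con 0ℚ) refl c (M o l 1) (M o l 0) ⟩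
    M o l 1 + 0ℚ ∎
  M-increment {o} {l} {c} {μ} a (suc (suc m)) = begin
    x′
      ≡⟨ solve 4 (λ c x y z → x := x :- (c :- con 1ℚ) :* y :- (c :+ con 1ℚ) :* (y :- (c :- con 1ℚ) :* z)
                                 :+ ((c :+ c) :* y :+ (con 1ℚ :- c :* c) :* z)) refl c x′ y′ z′ ⟩
    mul (c + 1ℚ) (mul (c - 1ℚ) (M o μ)) (suc (suc m)) + ((c + c) * y′ + (1ℚ - c * c) * z′)
      ≡⟨ cong₂ _+_ (M-add a (suc (suc m))) (cong₂ (λ y z → (c + c) * y + (1ℚ - c * c) * z) (M-increment a (suc m)) (M-increment a m)) ⟩
    mul c (mul c (M o l)) (suc (suc m)) + ((c + c) * (y + u) + (1ℚ - c * c) * (z + v))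
      ≡⟨ solve 6 (λ c x y z u v → x :- c :* y :- c :* (y :- c :* z) :+ ((c :+ c) :* (y :+ u) :+ (con 1ℚ :- c :* c) :* (z :+ v))
           := x :+ ((c :+ c) :* u :+ ((con 1ℚ :- c :* c) :* v :+ z))) refl c x y z u v ⟩
    x + ((c + c) * u + ((1ℚ - c * c) * v + z)) ∎
    where
    x′ = M o μ (suc (suc m))
    y′ = M o μ (suc m)
    z′ = M o μ m
    x = M o l (suc (suc m))
    y = M o l (suc m)
    z = M o l m
    u = rec (M o l) c (suc m)
    v = rec (M o l) c m

  -- Sums over the corners.

  -- With the contents x of the addable and y of the removable boxes of a
  -- partition l, this is ∑ F x - ∑ F y.
  I : (ℚ → ℚ) → ℚ → List ℕ → ℚ
  I F o []       = F o
  I F o (x ∷ xs) = F (ι x + o) - F (ι x + o - 1ℚ) + I F (o - 1ℚ) xs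

  I-cong : ∀ {F G} o l → F ≗ G → I F o l ≡ I G o l
  I-cong o []       eq = eq o
  I-cong o (x ∷ xs) eq = cong₂ _+_ (cong₂ _-_ (eq _) (eq _)) (I-cong (o - 1ℚ) xs eq)

  I-+ : ∀ F G o l → I (λ s → F s + G s) o l ≡ I F o l + I G o l
  I-+ F G o []       = refl
  I-+ F G o (x ∷ xs) = trans (cong (_+_ (F a + G a - (F b + G b))) (I-+ F G (o - 1ℚ) xs))
    (solve 6 (λ p q r s t u → (p :+ q :- (r :+ s)) :+ (t :+ u) := (p :- r :+ t) :+ (q :- s :+ u)) refl
      (F a) (G a) (F b) (G b) (I F (o - 1ℚ) xs) (I G (o - 1ℚ) xs))
    where
    a = ι x + o
    b = a - 1ℚ

  I-* : ∀ e F o l → I (λ s → e * F s) o l ≡ e * I F o l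
  I-* e F o []       = refl
  I-* e F o (x ∷ xs) = trans (cong (_+_ (e * F a - e * F b)) (I-* e F (o - 1ℚ) xs))
    (solve 4 (λ e p r t → (e :* p :- e :* r) :+ e :* t := e :* (p :- r :+ t)) refl
      e (F a) (F b) (I F (o - 1ℚ) xs))
    where
    a = ι x + o
    b = a - 1ℚ

  -- Up to cancellation, the addable content `c` gives way to `c + 1ℚ` and `c - 1ℚ`, and `c` becomes
  -- removable.
  I-add : ∀ F {o l c μ} → Add o l c μ → I F o μ ≡ I F o l + (F (c + 1ℚ) + F (c - 1ℚ) - (F c + F c))
  I-add F {o} new = begin
    F (1ℚ + o) - F (1ℚ + o - 1ℚ) + F (o - 1ℚ)
      ≡⟨ cong₂ (λ p q → F p - F q + F (o - 1ℚ)) (ℚ.+-comm 1ℚ o) (solve 1 (λ o → con 1ℚ :+ o :- con 1ℚ := o) refl o) ⟩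
    F (o + 1ℚ) - F o + F (o - 1ℚ)
      ≡⟨ solve 3 (λ p q r → p :- q :+ r := q :+ (p :+ r :- (q :+ q))) refl (F (o + 1ℚ)) (F o) (F (o - 1ℚ)) ⟩
    F o + (F (o + 1ℚ) + F (o - 1ℚ) - (F o + F o)) ∎
  I-add F {o} (here {x = x} {xs}) = begin
    F (1ℚ + ι x + o) - F (1ℚ + ι x + o - 1ℚ) + J
      ≡⟨ cong₂ (λ p q → F p - F q + J) (solve 2 (λ x o → con 1ℚ :+ x :+ o := x :+ o :+ con 1ℚ) refl (ι x) o)
           (solve 2 (λ x o → con 1ℚ :+ x :+ o :- con 1ℚ := x :+ o) refl (ι x) o) ⟩
    F (c + 1ℚ) - F c + J
      ≡⟨ solve 4 (λ p q r j → p :- q :+ j := (q :- r :+ j) :+ (p :+ r :- (q :+ q))) refl (F (c + 1ℚ)) (F c) (F (c - 1ℚ)) J ⟩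
    F c - F (c - 1ℚ) + J + (F (c + 1ℚ) + F (c - 1ℚ) - (F c + F c)) ∎
    where
    c = ι x + o
    J = I F (o - 1ℚ) xs
  I-add F {o} {x ∷ xs} {c} (there a) = trans (cong (_+_ (F (ι x + o) - F (ι x + o - 1ℚ))) (I-add F a))
    (sym (ℚ.+-assoc (F (ι x + o) - F (ι x + o - 1ℚ)) (I F (o - 1ℚ) xs) _))

  -- As series, 1 / (1 - (c + 1) t) + 1 / (1 - (c - 1) t) - 2 / (1 - c t) is 2 t² divided by the
  -- product of the three denominators. So `rec` applies again, with source 2 / (1 - c t).
  ^-second-difference : ∀ c i → (c + 1ℚ) ^ i + (c - 1ℚ) ^ i - (c ^ i + c ^ i) ≡ rec (λ m → c ^ m + c ^ m) c i
  ^-second-difference c 0             = refl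
  ^-second-difference c 1             = solve 1 (λ c → (c :+ con 1ℚ) :* con 1ℚ :+ (c :- con 1ℚ) :* con 1ℚ :- (c :* con 1ℚ :+ c :* con 1ℚ) := con 0ℚ) refl c
  ^-second-difference c (suc (suc m)) = begin
    (c + 1ℚ) * ((c + 1ℚ) * x) + (c - 1ℚ) * ((c - 1ℚ) * y) - (c * (c * z) + c * (c * z))
      ≡⟨ solve 4 (λ c x y z → let 1′ = con 1ℚ in
           (c :+ 1′) :* ((c :+ 1′) :* x) :+ (c :- 1′) :* ((c :- 1′) :* y) :- (c :* (c :* z) :+ c :* (c :* z))
           := (c :+ c) :* ((c :+ 1′) :* x :+ (c :- 1′) :* y :- (c :* z :+ c :* z)) :+ ((1′ :- c :* c) :* (x :+ y :- (z :+ z)) :+ (z :+ z)))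
           refl c x y z ⟩
    (c + c) * ((c + 1ℚ) * x + (c - 1ℚ) * y - (c * z + c * z)) + ((1ℚ - c * c) * (x + y - (z + z)) + (z + z))
      ≡⟨ cong₂ (λ p q → (c + c) * p + ((1ℚ - c * c) * q + (z + z))) (^-second-difference c (suc m)) (^-second-difference c m) ⟩
    (c + c) * rec e c (suc m) + ((1ℚ - c * c) * rec e c m + (z + z)) ∎
    where
    x = (c + 1ℚ) ^ m
    y = (c - 1ℚ) ^ m
    z = c ^ m
    e = λ m → c ^ m + c ^ m

  -- Sums over hook lengths.

  Φ : (ℚ → ℚ) → ℕ → ℚ
  Φ F zero    = 0ℚ
  Φ F (suc n) = F (ι (suc n)) + Φ F n

  -- The sum of F over the hook lengths of a row of length n on top of xs: these
  -- are 1, …, n + length xs with certain values removed.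
  V : (ℚ → ℚ) → ℕ → List ℕ → ℚ
  V F n []       = Φ F n
  V F n (y ∷ ys) = V F (suc n) ys - F (ι (suc n) - ι y)

  hookSum : (ℚ → ℚ) → List ℕ → ℚ
  hookSum F []       = 0ℚ
  hookSum F (x ∷ xs) = V F x xs + hookSum F xs

  -- Over columns of equal length below, the hooks of the row are consecutive integers. Raising them
  -- by one gains a value at the first column and loses one at the last, that is, at an addable and
  -- at a removable box of `xs`. The values are `z - s`, where `z = ι (suc n) + o` is the content of
  -- the box added to the row.
  V-suc : ∀ F n o xs → V F (suc n) xs ≡ V F n xs + I (λ s → F (ι (suc n) + o - s)) o xs
  V-suc F n o [] = trans (ℚ.+-comm (F (ι (suc n))) (Φ F n))
    (cong (λ u → Φ F n + F u) (solve 2 (λ x o → x := x :+ o :- o) refl (ι (suc n)) o))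
  V-suc F n o (y ∷ ys) = begin
    V F (suc (suc n)) ys - F (ι (suc (suc n)) - ι y)
      ≡⟨ cong (_- F (ι (suc (suc n)) - ι y)) (V-suc F (suc n) (o - 1ℚ) ys) ⟩
    v + I (λ s → F (ι (suc (suc n)) + (o - 1ℚ) - s)) (o - 1ℚ) ys - F (ι (suc (suc n)) - ι y)
      ≡⟨ cong₂ (λ i u → v + i - F u)
           (I-cong (o - 1ℚ) ys λ s → cong F (solve 3 (λ n o s → con 1ℚ :+ n :+ (o :- con 1ℚ) :- s := n :+ o :- s) refl (ι (suc n)) o s))
           (solve 3 (λ n o y → con 1ℚ :+ n :- y := n :+ o :- (y :+ o :- con 1ℚ)) refl (ι (suc n)) o (ι y)) ⟩
    v + J - F (z - (ι y + o - 1ℚ))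
      ≡⟨ solve 4 (λ v j p q → v :+ j :- p := v :- q :+ (q :- p :+ j)) refl v J (F (z - (ι y + o - 1ℚ))) (F (z - (ι y + o))) ⟩
    v - F (z - (ι y + o)) + (F (z - (ι y + o)) - F (z - (ι y + o - 1ℚ)) + J)
      ≡⟨ cong (λ u → v - F u + (F (z - (ι y + o)) - F (z - (ι y + o - 1ℚ)) + J)) (gap-here n o y) ⟩
    v - F (ι (suc n) - ι y) + (F (z - (ι y + o)) - F (z - (ι y + o - 1ℚ)) + J) ∎
    where
    z = ι (suc n) + o
    v = V F (suc n) ys
    J = I (λ s → F (z - s)) (o - 1ℚ) ys

  -- The additive counterpart of `k-add`: the hook `gap n o c - 1ℚ` becomes `gap n o c`.
  V-add : ∀ F {o xs c μ} → Add o xs c μ → ∀ n → V F n μ ≡ V F n xs + (F (gap n o c) - F (gap n o c - 1ℚ))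
  V-add F {o} new n = begin
    F (ι (suc n)) + Φ F n - F (ι (suc n) - 1ℚ)
      ≡⟨ solve 3 (λ p q r → p :+ q :- r := q :+ (p :- r)) refl (F (ι (suc n))) (Φ F n) (F (ι (suc n) - 1ℚ)) ⟩
    Φ F n + (F (ι (suc n)) - F (ι (suc n) - 1ℚ))
      ≡⟨ cong (λ g → Φ F n + (F g - F (g - 1ℚ))) (gap-new n o) ⟨
    Φ F n + (F (gap n o o) - F (gap n o o - 1ℚ)) ∎
  V-add F {o} (here {x = y} {ys}) n = begin
    v - F (ι (suc n) - (1ℚ + ι y))
      ≡⟨ cong (λ u → v - F u) (solve 3 (λ n o y → n :- (con 1ℚ :+ y) := n :+ o :- (y :+ o) :- con 1ℚ) refl (ι (suc n)) o (ι y)) ⟩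
    v - F (g - 1ℚ)
      ≡⟨ solve 3 (λ p q r → p :- q := p :- r :+ (r :- q)) refl v (F (g - 1ℚ)) (F g) ⟩
    v - F g + (F g - F (g - 1ℚ))
      ≡⟨ cong (λ u → v - F u + (F g - F (g - 1ℚ))) (gap-here n o y) ⟩
    v - F (ι (suc n) - ι y) + (F g - F (g - 1ℚ)) ∎
    where
    g = gap n o (ι y + o)
    v = V F (suc n) ys
  V-add F {o} {y ∷ ys} {c} {_ ∷ μ} (there a) n = begin
    V F (suc n) μ - e               ≡⟨ cong (_- e) (V-add F a (suc n)) ⟩
    V F (suc n) ys + (F (gap (suc n) (o - 1ℚ) c) - F (gap (suc n) (o - 1ℚ) c - 1ℚ)) - e
                                    ≡⟨ cong (λ g → V F (suc n) ys + (F g - F (g - 1ℚ)) - e) (gap-there n o c) ⟩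
    V F (suc n) ys + (p - q) - e    ≡⟨ solve 4 (λ v p q e → v :+ (p :- q) :- e := v :- e :+ (p :- q)) refl (V F (suc n) ys) p q e ⟩
    V F (suc n) ys - e + (p - q)    ∎
    where
    e = F (ι (suc n) - ι y)
    p = F (gap n o c)
    q = F (gap n o c - 1ℚ)

  -- The row of the new box changes by `V-suc`, with arguments `c - s`; the rows above change by
  -- `V-add`, with arguments of the form `s - c`, which evenness turns around. The sum over corners
  -- also has the entry `F 0ℚ - F 1ℚ` for the growing row itself, where no hook changes in this way;
  -- the constant removes it.
  hookSum-add : ∀ F → (∀ x → F (- x) ≡ F x) → ∀ {o l c μ} → Add o l c μ →
    hookSum F μ ≡ hookSum F l + (I (λ s → F (c - s)) o l + (F 1ℚ - F 0ℚ))
  hookSum-add F even {o} new = begin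
    F 1ℚ + 0ℚ + 0ℚ                    ≡⟨ solve 2 (λ p q → p :+ con 0ℚ :+ con 0ℚ := con 0ℚ :+ (q :+ (p :- q))) refl (F 1ℚ) (F 0ℚ) ⟩
    0ℚ + (F 0ℚ + (F 1ℚ - F 0ℚ))       ≡⟨ cong (λ u → 0ℚ + (F u + (F 1ℚ - F 0ℚ))) (ℚ.+-inverseʳ o) ⟨
    0ℚ + (F (o - o) + (F 1ℚ - F 0ℚ))  ∎
  hookSum-add F even {o} (here {x = x} {xs}) = begin
    V F (suc x) xs + h          ≡⟨ cong (_+ h) (trans (V-suc F x (o - 1ℚ) xs) (cong (_+_ (V F x xs)) (I-cong (o - 1ℚ) xs λ s →
                                     cong F (solve 3 (λ x o s → con 1ℚ :+ x :+ (o :- con 1ℚ) :- s := x :+ o :- s) refl (ι x) o s)))) ⟩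
    V F x xs + J + h            ≡⟨ solve 5 (λ v j h p q → v :+ j :+ h := v :+ h :+ (q :- p :+ j :+ (p :- q))) refl (V F x xs) J h (F 1ℚ) (F 0ℚ) ⟩
    V F x xs + h + (F 0ℚ - F 1ℚ + J + (F 1ℚ - F 0ℚ))
      ≡⟨ cong₂ (λ u v → V F x xs + h + (F u - F v + J + (F 1ℚ - F 0ℚ))) (sym (ℚ.+-inverseʳ c))
           (solve 2 (λ x o → con 1ℚ := x :+ o :- (x :+ o :- con 1ℚ)) refl (ι x) o) ⟩
    V F x xs + h + (F (c - c) - F (c - (c - 1ℚ)) + J + (F 1ℚ - F 0ℚ)) ∎
    where
    c = ι x + o
    h = hookSum F xs
    J = I (λ s → F (c - s)) (o - 1ℚ) xs
  hookSum-add F even {o} {x ∷ xs} {c} {_ ∷ μ} (there ad) = begin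
    V F x μ + hookSum F μ
      ≡⟨ cong₂ _+_ (V-add F ad x) (hookSum-add F even ad) ⟩
    v + (F (gap x (o - 1ℚ) c) - F (gap x (o - 1ℚ) c - 1ℚ)) + (h + (J + (F 1ℚ - F 0ℚ)))
      ≡⟨ cong₂ (λ p q → v + (p - q) + (h + (J + (F 1ℚ - F 0ℚ))))
           (trans (sym (even _)) (cong F (solve 3 (λ x o c → :- (con 1ℚ :+ x :+ (o :- con 1ℚ) :- c) := c :- (x :+ o)) refl (ι x) o c)))
           (trans (sym (even _)) (cong F (solve 3 (λ x o c → :- (con 1ℚ :+ x :+ (o :- con 1ℚ) :- c :- con 1ℚ) := c :- (x :+ o :- con 1ℚ)) refl (ι x) o c))) ⟩
    v + (F (c - a) - F (c - (a - 1ℚ))) + (h + (J + (F 1ℚ - F 0ℚ)))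
      ≡⟨ solve 6 (λ v p q h j r → v :+ (p :- q) :+ (h :+ (j :+ r)) := v :+ h :+ (p :- q :+ j :+ r)) refl
           v (F (c - a)) (F (c - (a - 1ℚ))) h J (F 1ℚ - F 0ℚ) ⟩
    v + h + (F (c - a) - F (c - (a - 1ℚ)) + J + (F 1ℚ - F 0ℚ)) ∎
    where
    a = ι x + o
    v = V F x xs
    h = hookSum F xs
    J = I (λ s → F (c - s)) (o - 1ℚ) xs

  -- Weighted polynomials and their change under adding a box.

  evenPow : ℕ → ℚ → ℚ
  evenPow j x = (x * x) ^ j

  evenPow-even : ∀ j x → evenPow j (- x) ≡ evenPow j x
  evenPow-even j x = cong (_^ j) (solve 1 (λ x → (:- x) :* (:- x) := x :* x) refl x)

  -- The index bounds the weight from above. The family is inductive so that `increment` can recurse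
  -- on the way a function is built. Averaging produces `moment`, and the change of `hooks` produces
  -- `power`.
  data DPoly : ℕ → (List ℕ → ℚ) → Set where
    const  : ∀ p → DPoly 0 λ _ → p
    moment : ∀ m → DPoly m λ l → M 0ℚ l m
    power  : ∀ i → DPoly i λ l → I (_^ i) 0ℚ l
    hooks  : ∀ j → DPoly (2 ℕ.+ (j ℕ.+ j)) (hookSum (evenPow j))
    add    : ∀ {w f g} → DPoly w f → DPoly w g → DPoly w λ l → f l + g l
    times  : ∀ {w v f g} → DPoly w f → DPoly v g → DPoly (w ℕ.+ v) λ l → f l * g l
    weaken : ∀ {w v f} → w ≤ v → DPoly w f → DPoly v f

  -- Polynomials in c with coefficients from DPoly; the index exceeds the weight by 2,
  -- so that nothing but 0 has index at most 1.
  data CPoly : ℕ → (List ℕ → ℚ → ℚ) → Set where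
    null   : CPoly 0 λ _ _ → 0ℚ
    mono   : ∀ {w f} → DPoly w f → ∀ m → CPoly (2 ℕ.+ (m ℕ.+ w)) λ l c → f l * c ^ m
    plus   : ∀ {v g h} → CPoly v g → CPoly v h → CPoly v λ l c → g l c + h l c
    weaken : ∀ {v u g} → v ≤ u → CPoly v g → CPoly u g
    ext    : ∀ {v g h} → (∀ l c → g l c ≡ h l c) → CPoly v g → CPoly v h

  CPoly-scale : ∀ {u v a g} → DPoly u a → CPoly v g → CPoly (u ℕ.+ v) λ l c → a l * g l c
  CPoly-scale {a = a} a∈ null = ext (λ l c → sym (ℚ.*-zeroʳ (a l))) (weaken z≤n null)
  CPoly-scale {u} {a = a} a∈ (mono {w} {f} f∈ m) = ext (λ l c → ℚ.*-assoc (a l) (f l) (c ^ m))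
    (weaken (ℕ.≤-reflexive (eq u m w))
      (mono (times a∈ f∈) m))
    where
    eq : ∀ u m w → 2 ℕ.+ (m ℕ.+ (u ℕ.+ w)) ≡ u ℕ.+ (2 ℕ.+ (m ℕ.+ w))
    eq = solve-∀
  CPoly-scale {a = a} a∈ (plus {g = g} {h} p q) = ext (λ l c → sym (ℚ.*-distribˡ-+ (a l) (g l c) (h l c))) (plus (CPoly-scale a∈ p) (CPoly-scale a∈ q))
  CPoly-scale {u} a∈ (weaken v≤ p) = weaken (ℕ.+-monoʳ-≤ u v≤) (CPoly-scale a∈ p)
  CPoly-scale {a = a} a∈ (ext eq p) = ext (λ l c → cong (a l *_) (eq l c)) (CPoly-scale a∈ p)

  CPoly-c* : ∀ {v g} → CPoly v g → CPoly (suc v) λ l c → c * g l c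
  CPoly-c* null = ext (λ l c → sym (ℚ.*-zeroʳ c)) (weaken z≤n null)
  CPoly-c* (mono {f = f} f∈ m) = ext (λ l c → solve 3 (λ f c x → f :* (c :* x) := c :* (f :* x)) refl (f l) c (c ^ m)) (mono f∈ (suc m))
  CPoly-c* (plus {g = g} {h} p q) = ext (λ l c → sym (ℚ.*-distribˡ-+ c (g l c) (h l c))) (plus (CPoly-c* p) (CPoly-c* q))
  CPoly-c* (weaken v≤ p) = weaken (s≤s v≤) (CPoly-c* p)
  CPoly-c* (ext eq p) = ext (λ l c → cong (c *_) (eq l c)) (CPoly-c* p)

  CPoly-c^* : ∀ m {v g} → CPoly v g → CPoly (m ℕ.+ v) λ l c → c ^ m * g l c
  CPoly-c^* zero    {g = g} p = ext (λ l c → sym (ℚ.*-identityˡ (g l c))) p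
  CPoly-c^* (suc m) {g = g} p = ext (λ l c → sym (ℚ.*-assoc c (c ^ m) (g l c))) (CPoly-c* (CPoly-c^* m p))

  -- Since indices exceed weights by 2, the bound is generous by 2. It is all that the product of
  -- two increments needs.
  CPoly-times : ∀ {v u g h} → CPoly v g → CPoly u h → CPoly (v ℕ.+ u) λ l c → g l c * h l c
  CPoly-times {h = h} null q = ext (λ l c → sym (ℚ.*-zeroˡ (h l c))) (weaken z≤n null)
  CPoly-times {u = u} {h = h} (mono {w} {f} f∈ m) q = ext (λ l c → solve 3 (λ f x h → x :* (f :* h) := f :* x :* h) refl (f l) (c ^ m) (h l c))
    (weaken (ℕ.m≤n⇒m≤1+n (ℕ.m≤n⇒m≤1+n (ℕ.≤-reflexive (sym (ℕ.+-assoc m w u))))) (CPoly-c^* m (CPoly-scale f∈ q)))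
  CPoly-times {h = h} (plus {g = g} {g′} p p′) q = ext (λ l c → sym (ℚ.*-distribʳ-+ (h l c) (g l c) (g′ l c))) (plus (CPoly-times p q) (CPoly-times p′ q))
  CPoly-times {u = u} (weaken v≤ p) q = weaken (ℕ.+-monoˡ-≤ u v≤) (CPoly-times p q)
  CPoly-times {h = h} (ext eq p) q = ext (λ l c → cong (_* h l c) (eq l c)) (CPoly-times p q)

  CPoly-const : ∀ p → CPoly 2 λ _ _ → p
  CPoly-const p = ext (λ _ _ → ℚ.*-identityʳ p) (mono (const p) 0)

  -- `rec` delays its source by two places: a source of weight `i` leads to weight `i` minus 2,
  -- hence to index `i`. The two starting values are 0, as the indices 0 and 1 require.
  CPoly-rec : ∀ {e : List ℕ → ℚ → ℕ → ℚ} → (∀ i → CPoly (2 ℕ.+ i) λ l c → e l c i) → ∀ i → CPoly i λ l c → rec (e l c) c i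
  CPoly-rec e∈ 0 = null
  CPoly-rec e∈ 1 = weaken z≤n null
  CPoly-rec {e} e∈ (suc (suc m)) = ext
    (λ l c → solve 4 (λ c x y z → c :* (x :+ x) :+ (y :+ c :* (c :* (con (- 1ℚ) :* y)) :+ z)
                               := (c :+ c) :* x :+ ((con 1ℚ :- c :* c) :* y :+ z)) refl c (rec (e l c) c (suc m)) (rec (e l c) c m) (e l c m))
    (plus (CPoly-c* (plus (CPoly-rec e∈ (suc m)) (CPoly-rec e∈ (suc m))))
          (plus (plus (weaken (ℕ.m≤n+m m 2) (CPoly-rec e∈ m)) (CPoly-c* (CPoly-c* (CPoly-scale (const (- 1ℚ)) (CPoly-rec e∈ m))))) (e∈ m)))

  -- Each step expands one factor (c - s)² = c² - 2 c s + s²; the exponent `i` collects the powers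
  -- of `s`.
  CPoly-I : ∀ k i → CPoly (2 ℕ.+ (k ℕ.+ k ℕ.+ i)) λ l c → I (λ s → evenPow k (c - s) * s ^ i) 0ℚ l
  CPoly-I zero    i = ext (λ l c → trans (ℚ.*-identityʳ _) (I-cong 0ℚ l λ s → sym (ℚ.*-identityˡ (s ^ i)))) (mono (power i) 0)
  CPoly-I (suc k) i = ext eq
    (plus (weaken (ℕ.≤-reflexive (w1 k i))
            (CPoly-c* (CPoly-c* (CPoly-I k i))))
      (plus (weaken (ℕ.≤-reflexive (w2 k i))
              (CPoly-scale (const (- (1ℚ + 1ℚ))) (CPoly-c* (CPoly-I k (suc i)))))
            (weaken (ℕ.≤-reflexive (w3 k i))
              (CPoly-I k (suc (suc i))))))
    where
    w1 : ∀ k i → 4 ℕ.+ (k ℕ.+ k ℕ.+ i) ≡ 2 ℕ.+ (suc k ℕ.+ suc k ℕ.+ i)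
    w1 = solve-∀
    w2 : ∀ k i → 3 ℕ.+ (k ℕ.+ k ℕ.+ suc i) ≡ 2 ℕ.+ (suc k ℕ.+ suc k ℕ.+ i)
    w2 = solve-∀
    w3 : ∀ k i → 2 ℕ.+ (k ℕ.+ k ℕ.+ (2 ℕ.+ i)) ≡ 2 ℕ.+ (suc k ℕ.+ suc k ℕ.+ i)
    w3 = solve-∀
    G : ℚ → ℕ → ℚ → ℚ
    G c i s = evenPow k (c - s) * s ^ i
    eq : ∀ l c → c * (c * I (G c i) 0ℚ l) + ((- (1ℚ + 1ℚ)) * (c * I (G c (suc i)) 0ℚ l) + I (G c (suc (suc i))) 0ℚ l)
       ≡ I (λ s → evenPow (suc k) (c - s) * s ^ i) 0ℚ l
    eq l c = begin
      c * (c * I (G c i) 0ℚ l) + ((- (1ℚ + 1ℚ)) * (c * I (G c (suc i)) 0ℚ l) + I (G c (suc (suc i))) 0ℚ l)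
        ≡⟨ solve 4 (λ c x y z → c :* (c :* x) :+ (con (- (1ℚ + 1ℚ)) :* (c :* y) :+ z) := c :* c :* x :+ (con (- (1ℚ + 1ℚ)) :* c :* y :+ z)) refl
             c (I (G c i) 0ℚ l) (I (G c (suc i)) 0ℚ l) (I (G c (suc (suc i))) 0ℚ l) ⟩
      c * c * I (G c i) 0ℚ l + ((- (1ℚ + 1ℚ)) * c * I (G c (suc i)) 0ℚ l + I (G c (suc (suc i))) 0ℚ l)
        ≡⟨ cong₂ (λ x y → x + (y + I (G c (suc (suc i))) 0ℚ l)) (I-* (c * c) (G c i) 0ℚ l) (I-* ((- (1ℚ + 1ℚ)) * c) (G c (suc i)) 0ℚ l) ⟨
      I F₁ 0ℚ l + (I F₂ 0ℚ l + I (G c (suc (suc i))) 0ℚ l)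
        ≡⟨ cong (_+_ (I F₁ 0ℚ l)) (I-+ F₂ (G c (suc (suc i))) 0ℚ l) ⟨
      I F₁ 0ℚ l + I (λ s → F₂ s + G c (suc (suc i)) s) 0ℚ l
        ≡⟨ I-+ F₁ (λ s → F₂ s + G c (suc (suc i)) s) 0ℚ l ⟨
      I (λ s → F₁ s + (F₂ s + G c (suc (suc i)) s)) 0ℚ l
        ≡⟨ I-cong 0ℚ l (λ s → solve 4 (λ c s x y → c :* c :* (x :* y) :+ (con (- (1ℚ + 1ℚ)) :* c :* (x :* (s :* y)) :+ x :* (s :* (s :* y)))
             := (c :- s) :* (c :- s) :* x :* y) refl c s (evenPow k (c - s)) (s ^ i)) ⟩
      I (λ s → evenPow (suc k) (c - s) * s ^ i) 0ℚ l ∎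
      where
      F₁ F₂ : ℚ → ℚ
      F₁ s = c * c * G c i s
      F₂ s = (- (1ℚ + 1ℚ)) * c * G c (suc i) s

  increment : ∀ {w f} → DPoly w f → Σ (List ℕ → ℚ → ℚ) λ g → CPoly w g × (∀ {l c μ} → Add 0ℚ l c μ → f μ ≡ f l + g l c)
  increment (const p)  = _ , null , λ _ → sym (ℚ.+-identityʳ p)
  increment (moment m) = _ , CPoly-rec (λ i → ext (λ l c → ℚ.*-identityʳ (M 0ℚ l i)) (mono (moment i) 0)) m , λ a → M-increment a m
  increment (power i)  = _ , CPoly-rec (λ i → ext (λ l c → trans (ℚ.*-comm (1ℚ + 1ℚ) (c ^ i))
      (solve 1 (λ x → x :* con (1ℚ + 1ℚ) := x :+ x) refl (c ^ i)))
      (weaken (ℕ.≤-reflexive (cong (2 ℕ.+_) (ℕ.+-identityʳ i))) (mono (const (1ℚ + 1ℚ)) i))) i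
    , λ {l} {c} a → trans (I-add (_^ i) a) (cong (_+_ (I (_^ i) 0ℚ l)) (^-second-difference c i))
  -- The corner sum of (c - s)^(2j) has weight 2j, which is why `hooks j` is given weight 2j + 2.
  increment (hooks j)  = _ , plus (ext (λ l c → I-cong 0ℚ l λ s → ℚ.*-identityʳ (evenPow j (c - s)))
        (weaken (ℕ.≤-reflexive (cong (2 ℕ.+_) (ℕ.+-identityʳ (j ℕ.+ j)))) (CPoly-I j 0)))
      (weaken (ℕ.m≤m+n 2 (j ℕ.+ j)) (CPoly-const (evenPow j 1ℚ - evenPow j 0ℚ)))
    , hookSum-add (evenPow j) (evenPow-even j)
  increment (add {f = f} {g} f∈ g∈) with increment f∈ | increment g∈
  ... | f′ , f′∈ , eqf | g′ , g′∈ , eqg = _ , plus f′∈ g′∈ , λ {l} {c} a → trans (cong₂ _+_ (eqf a) (eqg a))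
    (solve 4 (λ a b c d → (a :+ b) :+ (c :+ d) := (a :+ c) :+ (b :+ d)) refl (f l) (f′ l c) (g l) (g′ l c))
  increment (times {w} {v} {f} {g} f∈ g∈) with increment f∈ | increment g∈
  ... | f′ , f′∈ , eqf | g′ , g′∈ , eqg = _ ,
    plus (CPoly-scale f∈ g′∈) (plus (weaken (ℕ.≤-reflexive (ℕ.+-comm v w)) (CPoly-scale g∈ f′∈)) (CPoly-times f′∈ g′∈)) ,
    λ {l} {c} a → trans (cong₂ _*_ (eqf a) (eqg a))
      (solve 4 (λ a b c d → (a :+ b) :* (c :+ d) := a :* c :+ (a :* d :+ (c :* b :+ b :* d))) refl (f l) (f′ l c) (g l) (g′ l c))
  increment (weaken w≤ f∈) with increment f∈
  ... | f′ , f′∈ , eqf = f′ , weaken w≤ f′∈ , eqf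

  CPoly≤1⇒0 : ∀ {v g} → CPoly v g → v ≤ 1 → ∀ l c → g l c ≡ 0ℚ
  CPoly≤1⇒0 null          _   l c = refl
  CPoly≤1⇒0 (mono f∈ m)   (s≤s ())
  CPoly≤1⇒0 (plus p q)    v≤1 l c = cong₂ _+_ (CPoly≤1⇒0 p v≤1 l c) (CPoly≤1⇒0 q v≤1 l c)
  CPoly≤1⇒0 (weaken u≤ p) v≤1 l c = CPoly≤1⇒0 p (ℕ.≤-trans u≤ v≤1) l c
  CPoly≤1⇒0 (ext eq p)    v≤1 l c = trans (sym (eq l c)) (CPoly≤1⇒0 p v≤1 l c)

  expectation : ∀ {v g} → CPoly v g → ∀ w → v ≤ 2 ℕ.+ w →
    Σ (List ℕ → ℚ) λ f → DPoly w f × (∀ l → Linked _≥_ l → Sum 0ℚ l (λ c μ → K μ * g l c) ≡ K l * f l)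
  expectation null w _ = _ , weaken z≤n (const 0ℚ) , λ l _ → begin
    Sum 0ℚ l (λ c μ → K μ * 0ℚ) ≡⟨ Sum-cong l (λ {_} {μ} _ → ℚ.*-comm (K μ) 0ℚ) ⟩
    Sum 0ℚ l (λ c μ → 0ℚ * K μ) ≡⟨ Sum-* l 0ℚ (λ _ → K) ⟩
    0ℚ * Sum 0ℚ l (λ c μ → K μ) ≡⟨ ℚ.*-zeroˡ (Sum 0ℚ l λ _ → K) ⟩
    0ℚ                          ≡⟨ ℚ.*-zeroʳ (K l) ⟨
    K l * 0ℚ                    ∎
  expectation (mono {v} {f} f∈ m) w (s≤s (s≤s v≤)) = _ , weaken v≤ (times (moment m) f∈) , λ l ll → begin
    Sum 0ℚ l (λ c μ → K μ * (f l * c ^ m))   ≡⟨ Sum-cong l (λ {c} {μ} _ → solve 3 (λ k f x → k :* (f :* x) := f :* (k :* x)) refl (K μ) (f l) (c ^ m)) ⟩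
    Sum 0ℚ l (λ c μ → f l * (K μ * c ^ m))   ≡⟨ Sum-* l (f l) (λ c μ → K μ * c ^ m) ⟩
    f l * Sum 0ℚ l (λ c μ → K μ * c ^ m)     ≡⟨ cong (f l *_) (Sum-moment 0ℚ l ll m) ⟩
    f l * (K l * M 0ℚ l m)                   ≡⟨ solve 3 (λ k f x → f :* (k :* x) := k :* (x :* f)) refl (K l) (f l) (M 0ℚ l m) ⟩
    K l * (M 0ℚ l m * f l)                   ∎
  expectation (plus {g = g} {h} p q) w v≤ with expectation p w v≤ | expectation q w v≤
  ... | f , f∈ , eqf | f′ , f′∈ , eqf′ = _ , add f∈ f′∈ , λ l ll → begin
    Sum 0ℚ l (λ c μ → K μ * (g l c + h l c))         ≡⟨ Sum-cong l (λ {c} {μ} _ → ℚ.*-distribˡ-+ (K μ) (g l c) (h l c)) ⟩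
    Sum 0ℚ l (λ c μ → K μ * g l c + K μ * h l c)     ≡⟨ Sum-+ l (λ c μ → K μ * g l c) (λ c μ → K μ * h l c) ⟩
    Sum 0ℚ l (λ c μ → K μ * g l c) + Sum 0ℚ l (λ c μ → K μ * h l c) ≡⟨ cong₂ _+_ (eqf l ll) (eqf′ l ll) ⟩
    K l * f l + K l * f′ l                           ≡⟨ ℚ.*-distribˡ-+ (K l) (f l) (f′ l) ⟨
    K l * (f l + f′ l)                               ∎
  expectation (weaken u≤ p) w v≤ = expectation p w (ℕ.≤-trans u≤ v≤)
  expectation (ext eq p) w v≤ with expectation p w v≤
  ... | f , f∈ , eqf = f , f∈ , λ l ll → trans (Sum-cong l λ {c} {μ} _ → cong (K μ *_) (sym (eq l c))) (eqf l ll)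

  Sum-fK : ∀ {w f} → DPoly w f → ∀ v → w ≤ 2 ℕ.+ v →
    Σ (List ℕ → ℚ) λ f′ → DPoly v f′ × (∀ l → Linked _≥_ l → Sum 0ℚ l (λ _ μ → f μ * K μ) ≡ f l * K l + f′ l * K l)
  Sum-fK {f = f} f∈ v w≤ with increment f∈
  ... | g , g∈ , eqg with expectation g∈ v w≤
  ... | f′ , f′∈ , eqf′ = f′ , f′∈ , λ l ll → begin
    Sum 0ℚ l (λ _ μ → f μ * K μ)                        ≡⟨ Sum-cong l (λ {c} {μ} a → trans (cong (_* K μ) (eqg a))
                                                             (solve 3 (λ a b k → (a :+ b) :* k := a :* k :+ k :* b) refl (f l) (g l c) (K μ))) ⟩
    Sum 0ℚ l (λ c μ → f l * K μ + K μ * g l c)          ≡⟨ Sum-+ l (λ _ μ → f l * K μ) (λ c μ → K μ * g l c) ⟩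
    Sum 0ℚ l (λ _ μ → f l * K μ) + Sum 0ℚ l (λ c μ → K μ * g l c)
      ≡⟨ cong₂ _+_ (trans (Sum-* l (f l) (λ _ → K)) (cong (f l *_) (Sum-K 0ℚ l ll))) (trans (eqf′ l ll) (ℚ.*-comm (K l) (f′ l))) ⟩
    f l * K l + f′ l * K l                              ∎

  -- At weight at most 1 the increment has index at most 1 and so is 0: the descent ends here.
  Sum-fK-const : ∀ {w f} → DPoly w f → w ≤ 1 → ∀ l → Linked _≥_ l → Sum 0ℚ l (λ _ μ → f μ * K μ) ≡ f l * K l
  Sum-fK-const {f = f} f∈ w≤1 l ll with increment f∈
  ... | g , g∈ , eqg = begin
    Sum 0ℚ l (λ _ μ → f μ * K μ)   ≡⟨ Sum-cong l (λ {c} {μ} a → cong (_* K μ)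
                                        (trans (eqg a) (trans (cong (_+_ (f l)) (CPoly≤1⇒0 g∈ w≤1 l c)) (ℚ.+-identityʳ (f l))))) ⟩
    Sum 0ℚ l (λ _ μ → f l * K μ)   ≡⟨ Sum-* l (f l) (λ _ → K) ⟩
    f l * Sum 0ℚ l (λ _ → K)       ≡⟨ cong (f l *_) (Sum-K 0ℚ l ll) ⟩
    f l * K l                      ∎

  -- Comparison with the hook product and with the given functions.

  k*downTo : ∀ n xs → Linked _≥_ (n ∷ xs) → k n xs * ι (product (downTo 0 (n ℕ.+ length xs))) ≡ ι (product (nonHooks n xs))
  k*downTo n [] _ = trans (cong (λ m → invfact n * ι (product (downTo 0 m))) (ℕ.+-identityʳ n)) (go n)
    where
    go : ∀ n → invfact n * ι (product (downTo 0 n)) ≡ 1ℚ + 0ℚ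
    go zero    = refl
    go (suc n) = begin
      invfact n * recip n * ι (suc n ℕ.* product (downTo 0 n))
        ≡⟨ cong (invfact n * recip n *_) (ι-* (suc n) (product (downTo 0 n))) ⟩
      invfact n * recip n * (ι (suc n) * ι (product (downTo 0 n)))
        ≡⟨ solve 4 (λ f r s p → f :* r :* (s :* p) := f :* p :* (s :* r)) refl (invfact n) (recip n) (ι (suc n)) (ι (product (downTo 0 n))) ⟩
      invfact n * ι (product (downTo 0 n)) * (ι (suc n) * recip n)
        ≡⟨ cong₂ _*_ (go n) (ι-recip n) ⟩
      1ℚ + 0ℚ ∎
  k*downTo n (y ∷ ys) l@(n≥y ∷ _) = begin
    (ι (suc n) - ι y) * k (suc n) ys * ι (product (downTo 0 (n ℕ.+ suc (length ys))))
      ≡⟨ cong (λ m → (ι (suc n) - ι y) * k (suc n) ys * ι (product (downTo 0 m))) (ℕ.+-suc n (length ys)) ⟩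
    (ι (suc n) - ι y) * k (suc n) ys * ι (product (downTo 0 (suc n ℕ.+ length ys)))
      ≡⟨ ℚ.*-assoc (ι (suc n) - ι y) (k (suc n) ys) _ ⟩
    (ι (suc n) - ι y) * (k (suc n) ys * ι (product (downTo 0 (suc n ℕ.+ length ys))))
      ≡⟨ cong₂ _*_ (sym (ι-∸ (ℕ.m≤n⇒m≤1+n n≥y))) (k*downTo (suc n) ys (Linked-suc (Linked-skip l))) ⟩
    ι (suc n ∸ y) * ι (product (nonHooks (suc n) ys)) ≡⟨ ι-* (suc n ∸ y) _ ⟨
    ι ((suc n ∸ y) ℕ.* product (nonHooks (suc n) ys)) ∎

  -- By `k*downTo`, `k x xs` is the product of the non-hooks divided by the factorial of
  -- `x + length xs`; by `rowHooks-↭`, that factorial is the product of hooks and non-hooks.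
  k*rowHooks : ∀ x xs → Linked _≥_ (x ∷ xs) → k x xs * ι (product (rowHooks x xs)) ≡ 1ℚ
  k*rowHooks x xs l with product-nonHooks x xs l
  ... | d , eq = ι-cancel d (begin
    k x xs * ι p * ι (suc d)                                    ≡⟨ cong (λ e → k x xs * ι p * ι e) eq ⟨
    k x xs * ι p * ι (product (nonHooks x xs))                  ≡⟨ ℚ.*-assoc (k x xs) _ _ ⟩
    k x xs * (ι p * ι (product (nonHooks x xs)))                ≡⟨ cong (k x xs *_) (ι-* p _) ⟨
    k x xs * ι (p ℕ.* product (nonHooks x xs))                  ≡⟨ cong (λ e → k x xs * ι e) (product-++ (rowHooks x xs) (nonHooks x xs)) ⟨
    k x xs * ι (product (rowHooks x xs ++ nonHooks x xs))       ≡⟨ cong (λ e → k x xs * ι e) (product-↭ (rowHooks-↭ x xs l)) ⟩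
    k x xs * ι (product (downTo 0 (x ℕ.+ length xs)))           ≡⟨ k*downTo x xs l ⟩
    ι (product (nonHooks x xs))                                 ≡⟨ cong ι eq ⟩
    ι (suc d)                                                   ≡⟨ ℚ.*-identityˡ (ι (suc d)) ⟨
    1ℚ * ι (suc d)                                              ∎)
    where p = product (rowHooks x xs)

  K*Hprod : ∀ l → Linked _≥_ l → K l * ι (Hprod l) ≡ 1ℚ
  K*Hprod []       _ = refl
  K*Hprod (x ∷ xs) l = begin
    k x xs * K xs * ι (product (hookLengths (x ∷ xs)))
      ≡⟨ cong (λ h → k x xs * K xs * ι h) (trans (cong product (hookLengths-∷ x xs l)) (product-++ (rowHooks x xs) (hookLengths xs))) ⟩
    k x xs * K xs * ι (p ℕ.* Hprod xs)          ≡⟨ cong (k x xs * K xs *_) (ι-* p (Hprod xs)) ⟩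
    k x xs * K xs * (ι p * ι (Hprod xs))        ≡⟨ solve 4 (λ a b c d → a :* b :* (c :* d) := a :* c :* (b :* d)) refl (k x xs) (K xs) (ι p) (ι (Hprod xs)) ⟩
    k x xs * ι p * (K xs * ι (Hprod xs))        ≡⟨ cong₂ _*_ (k*rowHooks x xs l) (K*Hprod xs (tail l)) ⟩
    1ℚ                                          ∎
    where p = product (rowHooks x xs)

  divℚ-Hprod : ∀ a l → Linked _≥_ l → divℚ a (Hprod l) ≡ ι a * K l
  divℚ-Hprod a l ll = go (Hprod l) (K*Hprod l ll)
    where
    go : ∀ h → K l * ι h ≡ 1ℚ → divℚ a h ≡ ι a * K l
    -- The default value of `divℚ` never arises: a zero hook product would contradict `K*Hprod`.
    go zero    eq = contradiction (trans (sym (ℚ.*-zeroʳ (K l))) eq) λ ()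
    go (suc d) eq = trans (sym (ι*recip a d)) (cong (ι a *_) (ι-cancel d
      (trans (ℚ.*-comm (recip d) (ι (suc d))) (trans (ι-recip d) (sym eq)))))

  module _ (F : ℚ → ℚ) (G : ℕ → ℕ) (ιG : ∀ h → ι (G h) ≡ F (ι h)) where

    Φ-downTo : ∀ n → Φ F n ≡ ι (sum (map G (downTo 0 n)))
    Φ-downTo zero    = refl
    Φ-downTo (suc n) = trans (cong₂ _+_ (sym (ιG (suc n))) (Φ-downTo n)) (sym (ι-+ (G (suc n)) _))

    V-nonHooks : ∀ n xs → Linked _≥_ (n ∷ xs) →
      V F n xs + ι (sum (map G (nonHooks n xs))) ≡ ι (sum (map G (downTo 0 (n ℕ.+ length xs))))
    V-nonHooks n []       l = trans (ℚ.+-identityʳ (Φ F n)) (trans (Φ-downTo n) (cong (λ m → ι (sum (map G (downTo 0 m)))) (sym (ℕ.+-identityʳ n))))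
    V-nonHooks n (y ∷ ys) l@(n≥y ∷ _) = begin
      v - F (ι (suc n) - ι y) + ι (G (suc n ∸ y) ℕ.+ e)
        ≡⟨ cong₂ (λ p q → v - p + q) (trans (cong F (sym (ι-∸ (ℕ.m≤n⇒m≤1+n n≥y)))) (sym (ιG (suc n ∸ y)))) (ι-+ (G (suc n ∸ y)) e) ⟩
      v - ι (G (suc n ∸ y)) + (ι (G (suc n ∸ y)) + ι e)
        ≡⟨ solve 3 (λ v g e → v :- g :+ (g :+ e) := v :+ e) refl v (ι (G (suc n ∸ y))) (ι e) ⟩
      v + ι e
        ≡⟨ V-nonHooks (suc n) ys (Linked-suc (Linked-skip l)) ⟩
      ι (sum (map G (downTo 0 (suc n ℕ.+ length ys))))
        ≡⟨ cong (λ m → ι (sum (map G (downTo 0 m)))) (ℕ.+-suc n (length ys)) ⟨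
      ι (sum (map G (downTo 0 (n ℕ.+ suc (length ys))))) ∎
      where
      v = V F (suc n) ys
      e = sum (map G (nonHooks (suc n) ys))

    V-rowHooks : ∀ x xs → Linked _≥_ (x ∷ xs) → V F x xs ≡ ι (sum (map G (rowHooks x xs)))
    V-rowHooks x xs l = begin
      v              ≡⟨ solve 2 (λ v e → v := v :+ e :- e) refl v (ι e) ⟩
      v + ι e - ι e  ≡⟨ cong (_- ι e) (trans (V-nonHooks x xs l) (trans (cong ι (sym total)) (ι-+ r e))) ⟩
      ι r + ι e - ι e ≡⟨ solve 2 (λ v e → v := v :+ e :- e) refl (ι r) (ι e) ⟨
      ι r            ∎
      where
      v = V F x xs
      e = sum (map G (nonHooks x xs))
      r = sum (map G (rowHooks x xs))
      total : r ℕ.+ e ≡ sum (map G (downTo 0 (x ℕ.+ length xs)))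
      total = trans (sym (sum-++ (map G (rowHooks x xs)) (map G (nonHooks x xs))))
        (trans (cong sum (sym (map-++ G (rowHooks x xs) (nonHooks x xs)))) (sum-↭ (map⁺ G (rowHooks-↭ x xs l))))

    hookSum-hookLengths : ∀ l → Linked _≥_ l → hookSum F l ≡ ι (sum (map G (hookLengths l)))
    hookSum-hookLengths []       _ = refl
    hookSum-hookLengths (x ∷ xs) l = begin
      V F x xs + hookSum F xs                      ≡⟨ cong₂ _+_ (V-rowHooks x xs l) (hookSum-hookLengths xs (tail l)) ⟩
      ι (sum (map G r)) + ι (sum (map G h))        ≡⟨ ι-+ (sum (map G r)) (sum (map G h)) ⟨
      ι (sum (map G r) ℕ.+ sum (map G h))          ≡⟨ cong ι (sum-++ (map G r) (map G h)) ⟨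
      ι (sum (map G r ++ map G h))                 ≡⟨ cong (ι ∘ sum) (map-++ G r h) ⟨
      ι (sum (map G (r ++ h)))                     ≡⟨ cong (λ t → ι (sum (map G t))) (hookLengths-∷ x xs l) ⟨
      ι (sum (map G (hookLengths (x ∷ xs))))       ∎
      where
      r = rowHooks x xs
      h = hookLengths xs

  ι-^ : ∀ h j → ι (h ℕ.^ j) ≡ ι h ^ j
  ι-^ h zero    = refl
  ι-^ h (suc j) = trans (ι-* h (h ℕ.^ j)) (cong (ι h *_) (ι-^ h j))

  ι-evenPow : ∀ j h → ι (h ℕ.^ (2 ℕ.* j)) ≡ evenPow j (ι h)
  ι-evenPow j h = begin
    ι (h ℕ.^ (2 ℕ.* j))    ≡⟨ cong ι (ℕ.^-*-assoc h 2 j) ⟨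
    ι ((h ℕ.^ 2) ℕ.^ j)    ≡⟨ ι-^ (h ℕ.^ 2) j ⟩
    ι (h ℕ.^ 2) ^ j        ≡⟨ cong (_^ j) (trans (cong (λ e → ι (h ℕ.* e)) (ℕ.*-identityʳ h)) (ι-* h h)) ⟩
    evenPow j (ι h)        ∎

  hookPowers : List ℕ → List ℕ → ℚ
  hookPowers []      l = 1ℚ
  hookPowers (j ∷ ν) l = hookSum (evenPow j) l * hookPowers ν l

  weight : List ℕ → ℕ
  weight ν = (sum ν ℕ.+ length ν) ℕ.+ (sum ν ℕ.+ length ν)

  hookPowers-DPoly : ∀ ν → DPoly (weight ν) (hookPowers ν)
  hookPowers-DPoly []      = const 1ℚ
  hookPowers-DPoly (j ∷ ν) = weaken (ℕ.≤-reflexive (eq j (sum ν) (length ν))) (times (hooks j) (hookPowers-DPoly ν))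
    where
    eq : ∀ j s n → 2 ℕ.+ (j ℕ.+ j) ℕ.+ ((s ℕ.+ n) ℕ.+ (s ℕ.+ n)) ≡ (j ℕ.+ s ℕ.+ suc n) ℕ.+ (j ℕ.+ s ℕ.+ suc n)
    eq = solve-∀

  hookPowers≡gν : ∀ ν l → Linked _≥_ l → hookPowers ν l ≡ ι (gν ν l)
  hookPowers≡gν []      l ll = refl
  hookPowers≡gν (j ∷ ν) l ll = trans
    (cong₂ _*_ (hookSum-hookLengths (evenPow j) (ℕ._^ (2 ℕ.* j)) (ι-evenPow j) l ll) (hookPowers≡gν ν l ll))
    (sym (ι-* (sum (map (ℕ._^ (2 ℕ.* j)) (hookLengths l))) (gν ν l)))

  gνOverH≡ : ∀ ν l → IsPartition l → gνOverH ν l ≡ hookPowers ν l * K l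
  gνOverH≡ ν l (ll , _) = trans (divℚ-Hprod (gν ν l) l ll) (cong (_* K l) (sym (hookPowers≡gν ν l ll)))

  -- Matching sums over all rows with the list of partitions λ⁺.

  data Overhang : List ℕ → Set where
    here  : ∀ {p ys} → Overhang (p ∷ suc p ∷ ys)
    there : ∀ {x xs} → Overhang xs → Overhang (x ∷ xs)

  -- The first factor of `k p (suc p ∷ ys)` is `ι (suc p) - ι (suc p)`.
  overhang⇒K≡0 : ∀ {l} → Overhang l → K l ≡ 0ℚ
  overhang⇒K≡0 (here {p} {ys}) = solve 3 (λ s a b → (s :- s) :* a :* b := con 0ℚ) refl (ι (suc p)) (k (suc p) ys) (k (suc p) ys * K ys)
  overhang⇒K≡0 (there {x} {xs} b) = trans (cong (k x xs *_) (overhang⇒K≡0 b)) (ℚ.*-zeroʳ (k x xs))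

  IsPartition-∷ : ∀ {x y ys} → x ≥ y → IsPartition (y ∷ ys) → IsPartition (x ∷ y ∷ ys)
  IsPartition-∷ x≥y (l , 0<y ∷ p) = x≥y ∷ l , ℕ.≤-trans 0<y x≥y ∷ 0<y ∷ p

  IsPartition-suc : ∀ {y ys} → IsPartition (y ∷ ys) → IsPartition (suc y ∷ ys)
  IsPartition-suc (l , _ ∷ p) = Linked-suc l , s≤s z≤n ∷ p

  IsPartition-tail : ∀ {x xs} → IsPartition (x ∷ xs) → IsPartition xs
  IsPartition-tail (l , _ ∷ p) = tail l , p

  -- The row above `y` only decides whether the first entry of `addBox (y ∷ ys)` is kept.
  addBox-∷∷ : ∀ {x y ys b} → (y <ᵇ x) ≡ b →
    addBox (x ∷ y ∷ ys) ≡ (suc x ∷ y ∷ ys) ∷ map (x ∷_) (if b then addBox (y ∷ ys) else drop 1 (addBox (y ∷ ys)))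
  addBox-∷∷ refl = refl

  -- The recursion inside addBox is private to Defs and visible only as the part of
  -- addBox (x ∷ xs) after its head.
  record LowerAdditions (x : ℕ) (xs : List ℕ) : Set where
    field
      lower      : List (List ℕ)
      addBox≡    : addBox (x ∷ xs) ≡ (suc x ∷ xs) ∷ map (x ∷_) lower
      partitions : All (λ μ → IsPartition (x ∷ μ)) lower
      sum≡       : ∀ o (φ : List ℕ → ℚ) → (∀ {μ} → Overhang μ → φ μ ≡ 0ℚ) →
                   sumℚ (map (λ μ → φ (x ∷ μ)) lower) ≡ Sum o xs λ _ μ → φ (x ∷ μ)

  lowerAdditions : ∀ x xs → IsPartition (x ∷ xs) → LowerAdditions x xs
  lowerAdditions x [] p@(_ , 0<x ∷ _) = record
    { lower      = (1 ∷ []) ∷ []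
    ; addBox≡    = refl
    ; partitions = (0<x ∷ [-] , 0<x ∷ s≤s z≤n ∷ []) ∷ []
    ; sum≡       = λ o φ _ → ℚ.+-identityʳ (φ (x ∷ 1 ∷ []))
    }
  lowerAdditions x (y ∷ ys) p@(x≥y ∷ _ , _) with lowerAdditions y ys (IsPartition-tail p)
  ... | record { lower = R ; addBox≡ = eq ; partitions = ps ; sum≡ = sum≡ } with y <ᵇ x in y<ᵇx
  ... | true = record
    { lower      = (suc y ∷ ys) ∷ map (y ∷_) R
    ; addBox≡    = trans (addBox-∷∷ y<ᵇx) (cong (λ L → (suc x ∷ y ∷ ys) ∷ map (x ∷_) L) eq)
    ; partitions = IsPartition-∷ (ℕ.<ᵇ⇒< y x (subst T (sym y<ᵇx) _)) (IsPartition-suc (IsPartition-tail p))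
                   ∷ All.map⁺ (All.map (IsPartition-∷ x≥y) ps)
    ; sum≡       = λ o φ bad → cong (_+_ (φ (x ∷ suc y ∷ ys)))
        (trans (cong sumℚ (sym (map-∘ R))) (sum≡ (o - 1ℚ) (λ μ → φ (x ∷ μ)) λ b → bad (there b)))
    }
  ... | false = record
    { lower      = map (y ∷_) R
    ; addBox≡    = trans (addBox-∷∷ y<ᵇx) (cong (λ L → (suc x ∷ y ∷ ys) ∷ map (x ∷_) (drop 1 L)) eq)
    ; partitions = All.map⁺ (All.map (IsPartition-∷ x≥y) ps)
    -- Here `x ≡ y`: `addBox` omits the longer second row, while `Sum` includes it as an overhang,
    -- where `φ` is 0.
    ; sum≡       = λ o φ bad → begin
        sumℚ (map (λ μ → φ (x ∷ μ)) (map (y ∷_) R))       ≡⟨ cong sumℚ (map-∘ R) ⟨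
        sumℚ (map (λ μ → φ (x ∷ y ∷ μ)) R)                ≡⟨ sum≡ (o - 1ℚ) (λ μ → φ (x ∷ μ)) (λ b → bad (there b)) ⟩
        Sum (o - 1ℚ) ys (λ _ μ → φ (x ∷ y ∷ μ))           ≡⟨ ℚ.+-identityˡ _ ⟨
        0ℚ + Sum (o - 1ℚ) ys (λ _ μ → φ (x ∷ y ∷ μ))      ≡⟨ cong (_+ Sum (o - 1ℚ) ys (λ _ μ → φ (x ∷ y ∷ μ)))
                                                               (sym (bad (subst (λ z → Overhang (x ∷ suc z ∷ ys)) x≡y here))) ⟩
        φ (x ∷ suc y ∷ ys) + Sum (o - 1ℚ) ys (λ _ μ → φ (x ∷ y ∷ μ)) ∎
    }
    where
    x≡y : x ≡ y
    x≡y = ℕ.≤-antisym (ℕ.≮⇒≥ λ y<x → contradiction (trans (sym y<ᵇx) (<⇒<ᵇ≡true y<x)) λ ()) x≥y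

  addBox-partitions : ∀ l → IsPartition l → All IsPartition (addBox l)
  addBox-partitions []       p = ([-] , s≤s z≤n ∷ []) ∷ []
  addBox-partitions (x ∷ xs) p = subst (All IsPartition) (sym addBox≡) (IsPartition-suc p ∷ All.map⁺ partitions)
    where open LowerAdditions (lowerAdditions x xs p)

  sum-addBox : ∀ l → IsPartition l → ∀ φ → (∀ {μ} → Overhang μ → φ μ ≡ 0ℚ) → sumℚ (map φ (addBox l)) ≡ Sum 0ℚ l λ _ μ → φ μ
  sum-addBox []       p φ bad = ℚ.+-identityʳ (φ (1 ∷ []))
  sum-addBox (x ∷ xs) p φ bad = begin
    sumℚ (map φ (addBox (x ∷ xs)))                             ≡⟨ cong (λ L → sumℚ (map φ L)) addBox≡ ⟩
    φ (suc x ∷ xs) + sumℚ (map φ (map (x ∷_) lower))           ≡⟨ cong (λ L → φ (suc x ∷ xs) + sumℚ L) (map-∘ lower) ⟨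
    φ (suc x ∷ xs) + sumℚ (map (λ μ → φ (x ∷ μ)) lower)        ≡⟨ cong (_+_ (φ (suc x ∷ xs))) (sum≡ (0ℚ - 1ℚ) φ bad) ⟩
    φ (suc x ∷ xs) + Sum (0ℚ - 1ℚ) xs (λ _ μ → φ (x ∷ μ))      ∎
    where open LowerAdditions (lowerAdditions x xs p)

  -- Iterating the difference operator.

  _≈ₚ_ : (List ℕ → ℚ) → (List ℕ → ℚ) → Set
  f ≈ₚ g = ∀ l → IsPartition l → f l ≡ g l

  D-≈ₚ : ∀ {h f : List ℕ → ℚ} → h ≈ₚ (λ l → f l * K l) → ∀ l → IsPartition l →
    D h l ≡ Sum 0ℚ l (λ _ μ → f μ * K μ) - f l * K l
  D-≈ₚ {h} {f} h≈ l p = cong₂ _-_ (trans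
    (cong sumℚ (map-cong-local (All.map (λ {μ} → h≈ μ) (addBox-partitions l p))))
    (sum-addBox l p (λ μ → f μ * K μ) λ {μ} b → trans (cong (f μ *_) (overhang⇒K≡0 b)) (ℚ.*-zeroʳ (f μ))))
    (h≈ l p)

  Dpow-suc : ∀ r h → Dpow (suc r) h ≡ Dpow r (D h)
  Dpow-suc zero    h = refl
  Dpow-suc (suc r) h = cong D (Dpow-suc r h)

  -- Each `D` costs two units of weight. The bound `1 + 2 r` is the largest that `r` steps bring
  -- down to 1, where one more `D` gives 0.
  Dpow-vanishes : ∀ r {w f h} → DPoly w f → w ≤ 1 ℕ.+ (r ℕ.+ r) → h ≈ₚ (λ l → f l * K l) →
    ∀ l → IsPartition l → Dpow (suc r) h l ≡ 0ℚ
  Dpow-vanishes zero {f = f} {h} f∈ w≤ h≈ l p = trans (D-≈ₚ {h} {f} h≈ l p)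
    (trans (cong (_- f l * K l) (Sum-fK-const f∈ w≤ l (proj₁ p))) (ℚ.+-inverseʳ (f l * K l)))
  Dpow-vanishes (suc r) {w} {f} {h} f∈ w≤ h≈ l p = begin
    Dpow (suc (suc r)) h l   ≡⟨ cong (λ g → g l) (Dpow-suc (suc r) h) ⟩
    Dpow (suc r) (D h) l     ≡⟨ Dpow-vanishes r {f = f′} {D h} f′∈ ℕ.≤-refl Dh≈ l p ⟩
    0ℚ                       ∎
    where
    step = Sum-fK f∈ (1 ℕ.+ (r ℕ.+ r)) (subst (w ≤_) (cong (2 ℕ.+_) (ℕ.+-suc r r)) w≤)
    f′ = proj₁ step
    f′∈ = proj₁ (proj₂ step)
    Dh≈ : D h ≈ₚ (λ l → f′ l * K l)
    Dh≈ l p = begin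
      D h l                                            ≡⟨ D-≈ₚ {h} {f} h≈ l p ⟩
      Sum 0ℚ l (λ _ μ → f μ * K μ) - f l * K l         ≡⟨ cong (_- f l * K l) (proj₂ (proj₂ step) l (proj₁ p)) ⟩
      f l * K l + f′ l * K l - f l * K l               ≡⟨ solve 2 (λ a b → a :+ b :- a := b) refl (f l * K l) (f′ l * K l) ⟩
      f′ l * K l                                       ∎

open DPolynomials
open import Data.Nat using (ℕ; _+_)
open import Data.Nat.Properties using (+-comm; m≤n+m)
open import Data.List using (List; length)
open import Data.Nat.ListAction using (sum)
open import Data.Rational using (0ℚ)
open import Relation.Binary.PropositionalEquality using (_≡_; subst)

theorem1p5 : (ν : List ℕ) → IsPartition ν →
    (λ′ : List ℕ) → IsPartition λ′ →
    Dpow (sum ν + length ν + 1) (gνOverH ν) λ′ ≡ 0ℚ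
theorem1p5 ν _ λ′ p = subst (λ r → Dpow r (gνOverH ν) λ′ ≡ 0ℚ) (+-comm 1 (sum ν + length ν))
  -- The weight of the hook powers is twice `sum ν + length ν`, one less than the bound allows.
  (Dpow-vanishes (sum ν + length ν) {f = hookPowers ν} {gνOverH ν} (hookPowers-DPoly ν) (m≤n+m (weight ν) 1) (gνOverH≡ ν) λ′ p)
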